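{- Fix $d\ge2$. For all sufficiently large $N$, the number of combinatorially distinct simplicial LC $d$-spheres with $N$ facets is not larger than $$\Big(d\cdot\big(\tfrac{d}{d-1}\big)^{d-1}\cdot 2^{\frac{2d^2-d}{3}}\Big)^N .$$ The same upper bound holds, for all sufficiently large $N$, for the number of combinatorially distinct simplicial LC $d$-balls with $N$ facets.
   Context: All complexes are finite. A simplicial $d$-sphere (resp. $d$-ball) is a simplicial complex whose underlying space is homeomorphic to the $d$-sphere (resp. $d$-ball); facets are its $d$-dimensional faces. Combinatorially distinct means non-isomorphic as simplicial complexes. LC (locally constructible): A regular CW complex is simplicial if every lower interval $[0,F]$ in its face poset is boolean. A $d$-pseudomanifold is a finite, pure $d$-dimensional, simplicial regular CW complex in which each $(d-1)$-cell belongs to at most two $d$-cells; its boundary is the smallest subcomplex containing all $(d-1)$-cells that lie in exactly one $d$-cell. For $d\ge2$, a local construction for a pure $d$-dimensional simplicial complex $C$ with $N$ facets is a sequence $T_1,\dots,T_N,\dots,T_k$ ($k\ge N$) of $d$-pseudomanifolds such that: (1) $T_1$ is a $d$-simplex; (2) for $i\le N-1$, $T_{i+1}$ is obtained from $T_i$ by gluing a new $d$-simplex to $T_i$ along one of the $(d-1)$-cells of $\partial T_i$; (3) for $i\ge N$, $T_{i+1}$ is obtained from $T_i$ by identifying a pair of $(d-1)$-cells $\sigma,\tau$ in $\partial T_i$ whose intersection contains a $(d-2)$-cell $F$ (the identification being the simplicial one that fixes $F$ pointwise); (4) $T_k=C$. $C$ is LC if a local construction for $C$ exists. -}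

module Defs where

open import Algebra.Definitions.RawMonoid using (sum)
open import Data.Fin.Base using (Fin)
open import Data.Fin.Permutation using (Permutation; _⟨$⟩ʳ_)
open import Data.Fin.Subset using (Subset; ⊥; _∈_; _⊆_; ⁅_⁆; ∣_∣)
open import Data.Nat.Base using (ℕ; suc; _*_; _∸_; _^_; _≤_; _<_)
open import Data.Product using (Σ; ∃; ∃!; _×_; proj₁; proj₂)
open import Data.Rational.Base as ℚ using (ℚ; 0ℚ; 1ℚ)
open import Data.Sum.Base using (_⊎_)
open import Data.Vec.Base using (tabulate; lookup)
open import Function.Bundles using (_⇔_)
open import Function.Definitions using (Injective)
open import Level using (0ℓ)
open import Relation.Binary.Construct.Closure.Equivalence using (EqClosure)
open import Relation.Binary.Core using (Rel)
open import Relation.Binary.Definitions using (Minimum)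
open import Relation.Binary.Morphism.Structures using (IsOrderMonomorphism)
open import Relation.Binary.PropositionalEquality.Core using (_≡_; _≢_)
open import Relation.Binary.Structures using (IsDecPartialOrder)
open import Relation.Nullary.Negation.Core using (¬_)
open import Relation.Unary using (Decidable)

------------------------------------------------------------------------
-- Abstract simplicial complexes

-- The vertex set is Fin V and every element of it really is a vertex,
-- so that isomorphisms may be taken to be bijections of Fin V.
record SimplicialComplex : Set₁ where
  field
    V        : ℕ
    Face     : Subset V → Set
    face?    : Decidable Face
    vertices : ∀ v → Face ⁅ v ⁆
    empty    : Face ⊥
    closed   : ∀ {S T} → S ⊆ T → Face T → Face S

Isomorphic : SimplicialComplex → SimplicialComplex → Set
Isomorphic K L =
  Σ (Permutation K.V L.V) λ π →
    ∀ (S : Subset L.V) →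
      L.Face S ⇔ K.Face (tabulate λ v → lookup S (π ⟨$⟩ʳ v))
  where
  module K = SimplicialComplex K
  module L = SimplicialComplex L

-- A d-dimensional face has d + 1 vertices.
IsFacet : ℕ → (K : SimplicialComplex) → Subset (SimplicialComplex.V K) → Set
IsFacet d K S = SimplicialComplex.Face K S × ∣ S ∣ ≡ suc d

HasFacets : ℕ → ℕ → SimplicialComplex → Set
HasFacets d N K =
  Σ (Fin N → Subset (SimplicialComplex.V K)) λ f →
    Injective _≡_ _≡_ f × (∀ S → IsFacet d K S ⇔ ∃ λ i → f i ≡ S)

------------------------------------------------------------------------
-- Real numbers, as Cauchy sequences of rationals

-- The relations below compare the limits of Cauchy sequences.  They are
-- stated for arbitrary rational sequences, so that a polynomial in real
-- numbers is just the termwise polynomial in representing sequences.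
Seq : Set
Seq = ℕ → ℚ

Eventually : (ℕ → Set) → Set
Eventually P = ∃ λ n₀ → ∀ n → n₀ ≤ n → P n

const : ℚ → Seq
const q _ = q

infix 4 _≈_ _≲_ _≺_

_≈_ : Rel Seq 0ℓ
s ≈ t = ∀ ε → 0ℚ ℚ.< ε → Eventually λ n → ℚ.∣ s n ℚ.- t n ∣ ℚ.< ε

_≲_ : Rel Seq 0ℓ
s ≲ t = ∀ ε → 0ℚ ℚ.< ε → Eventually λ n → s n ℚ.< t n ℚ.+ ε

_≺_ : Rel Seq 0ℓ
s ≺ t = ∃ λ ε → 0ℚ ℚ.< ε × Eventually λ n → s n ℚ.+ ε ℚ.< t n

record ℝ : Set where
  field
    seq    : Seq
    cauchy : ∀ ε → 0ℚ ℚ.< ε → ∃ λ n₀ → ∀ m n → n₀ ≤ m → n₀ ≤ n →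
             ℚ.∣ seq m ℚ.- seq n ∣ ℚ.< ε

open ℝ public

------------------------------------------------------------------------
-- Subspaces of ℝⁿ and homeomorphisms between them

Region : ℕ → Set₁
Region n = (Fin n → ℝ) → Set

Point : ∀ {n} → Region n → Set
Point {n} P = Σ (Fin n → ℝ) P

_≋_ : ∀ {n} {P : Region n} → Rel (Point P) 0ℓ
x ≋ y = ∀ i → seq (proj₁ x i) ≈ seq (proj₁ y i)

-- Distance less than q in the maximum norm.
Near : ∀ {n} {P : Region n} → ℚ → Rel (Point P) 0ℓ
Near q x y =
  ∀ i → (λ n → ℚ.∣ seq (proj₁ x i) n ℚ.- seq (proj₁ y i) n ∣) ≺ const q

-- Continuity in particular makes f respect _≋_.
Continuous : ∀ {m n} {P : Region m} {Q : Region n} → (Point P → Point Q) → Set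
Continuous {P = P} {Q = Q} f =
  ∀ x ε → 0ℚ ℚ.< ε →
    ∃ λ δ → 0ℚ ℚ.< δ ×
      (∀ y → Near {P = P} δ x y → Near {P = Q} ε (f x) (f y))

record Homeomorphic {m n} (P : Region m) (Q : Region n) : Set where
  field
    to              : Point P → Point Q
    from            : Point Q → Point P
    to-continuous   : Continuous {P = P} {Q = Q} to
    from-continuous : Continuous {P = Q} {Q = P} from
    from∘to         : ∀ x → _≋_ {P = P} (from (to x)) x
    to∘from         : ∀ y → _≋_ {P = Q} (to (from y)) y

normSq : ∀ {n} → (Fin n → ℝ) → Seq
normSq x n = sum ℚ.+-0-rawMonoid λ i → seq (x i) n ℚ.* seq (x i) n

UnitSphere : ∀ d → Region (suc d)
UnitSphere d x = normSq x ≈ const 1ℚ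

UnitBall : ∀ d → Region d
UnitBall d x = normSq x ≲ const 1ℚ

-- Points of the underlying space are given by barycentric coordinates.
-- Since faces are closed under subsets, the last condition says that
-- the support of x is a face.
Realization : (K : SimplicialComplex) → Region (SimplicialComplex.V K)
Realization K x =
    (∀ v → const 0ℚ ≲ seq (x v))
  × (λ n → sum ℚ.+-0-rawMonoid λ v → seq (x v) n) ≈ const 1ℚ
  × (∀ S → (∀ v → v ∈ S → const 0ℚ ≺ seq (x v)) → SimplicialComplex.Face K S)

IsSphere : ℕ → SimplicialComplex → Set
IsSphere d K = Homeomorphic (Realization K) (UnitSphere d)

IsBall : ℕ → SimplicialComplex → Set
IsBall d K = Homeomorphic (Realization K) (UnitBall d)

------------------------------------------------------------------------
-- Finite simplicial regular CW complexes

-- A chart identifies the lower interval [0,F] with the boolean lattice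
-- of rank r.  Its existence says that F is an (r-1)-cell (a simplex with
-- r vertices), the empty cell being the one of rank 0.
record Chart {n} (_⊑_ : Rel (Fin n) 0ℓ) (r : ℕ) (F : Fin n) : Set where
  field
    cell                : Subset r → Fin n
    isOrderMonomorphism : IsOrderMonomorphism _≡_ _≡_ _⊆_ _⊑_ cell
    image               : ∀ G → G ⊑ F ⇔ ∃ λ S → cell S ≡ G

-- A regular CW complex is determined by its face poset, and every poset
-- with a least element and boolean lower intervals is such a face poset;
-- complexes are therefore given by these posets (empty cell included).
record CellComplex : Set₁ where
  field
    cells             : ℕ
    _⊑_               : Rel (Fin cells) 0ℓ
    isDecPartialOrder : IsDecPartialOrder _≡_ _⊑_
    emptyCell         : ∃ (Minimum _⊑_)
    simplicial        : ∀ F → ∃ λ r → Chart _⊑_ r F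

  Cell : Set
  Cell = Fin cells

  Rank : ℕ → Cell → Set
  Rank = Chart _⊑_

open CellComplex using (Cell; Rank)

-- The d-cells, (d-1)-cells and (d-2)-cells have ranks suc d, d and d ∸ 1
-- respectively.
record IsPseudomanifold (d : ℕ) (T : CellComplex) : Set where
  open CellComplex T using (_⊑_)
  field
    pure : ∀ G → ∃ λ F → Rank T (suc d) F × G ⊑ F
    thin : ∀ {G E F H} → Rank T d G →
           Rank T (suc d) E → Rank T (suc d) F → Rank T (suc d) H →
           G ⊑ E → G ⊑ F → G ⊑ H →
           E ≡ F ⊎ E ≡ H ⊎ F ≡ H

InBoundary : ℕ → (T : CellComplex) → Cell T → Set
InBoundary d T G =
  ∃ λ H → Rank T d H × ∃! _≡_ (λ F → Rank T (suc d) F × H ⊑ F) × G ⊑ H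
  where open CellComplex T using (_⊑_)

IsSimplex : ℕ → CellComplex → Set
IsSimplex d T = ∃ λ F → Rank T (suc d) F × (∀ G → G ⊑ F)
  where open CellComplex T using (_⊑_)

-- T′ is the union of a copy of T and a d-simplex [0,new], which meet
-- exactly in the (d-1)-cell σ.
record Glue (d : ℕ) (T T′ : CellComplex) : Set where
  open CellComplex T using (_⊑_)
  open CellComplex T′ using () renaming (_⊑_ to _⊑′_)
  field
    σ          : Cell T
    σ-rank     : Rank T d σ
    σ-boundary : InBoundary d T σ
    new        : Cell T′
    new-rank   : Rank T′ (suc d) new
    old        : Cell T → Cell T′
    old-mono   : IsOrderMonomorphism _≡_ _≡_ _⊑_ _⊑′_ old
    old-closed : ∀ {G x} → x ⊑′ old G → ∃ λ H → old H ≡ x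
    cover      : ∀ x → (∃ λ G → old G ≡ x) ⊎ x ⊑′ new
    meet       : ∀ x → ((∃ λ G → old G ≡ x) × x ⊑′ new) ⇔ x ⊑′ old σ

-- The simplicial isomorphism [0,σ] → [0,τ] is σ-chart S ↦ τ-chart S, and
-- T′ is the quotient of T, with the quotient order, by the equivalence
-- relation that this isomorphism generates.
record Identify (d : ℕ) (T T′ : CellComplex) : Set where
  open CellComplex T using (_⊑_)
  open CellComplex T′ using () renaming (_⊑_ to _⊑′_)
  field
    σ τ        : Cell T
    σ≢τ        : σ ≢ τ
    σ-chart    : Rank T d σ
    τ-chart    : Rank T d τ
    σ-boundary : InBoundary d T σ
    τ-boundary : InBoundary d T τ
    F          : Cell T
    F-rank     : Rank T (d ∸ 1) F
    F⊑σ        : F ⊑ σ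
    F⊑τ        : F ⊑ τ

  module σ = Chart σ-chart
  module τ = Chart τ-chart

  Match : Rel (Cell T) 0ℓ
  Match G H = ∃ λ S → σ.cell S ≡ G × τ.cell S ≡ H

  field
    fixes-F    : ∀ S → σ.cell S ⊑ F → τ.cell S ≡ σ.cell S
    quot       : Cell T → Cell T′
    surjective : ∀ x → ∃ λ G → quot G ≡ x
    kernel     : ∀ G H → quot G ≡ quot H ⇔ EqClosure Match G H
    order      : ∀ x y → x ⊑′ y ⇔
                 ∃ λ G → ∃ λ H → quot G ≡ x × quot H ≡ y × G ⊑ H

-- T is isomorphic to the face poset of K.
IsFacePosetOf : SimplicialComplex → CellComplex → Set
IsFacePosetOf K T =
  Σ (Cell T → Subset K.V) λ f →
    IsOrderMonomorphism _≡_ _≡_ _⊑_ _⊆_ f × (∀ S → K.Face S ⇔ ∃ λ G → f G ≡ S)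
  where
  module K = SimplicialComplex K
  open CellComplex T using (_⊑_)

------------------------------------------------------------------------
-- Local constructions

-- Only the values T 1, …, T k of the sequence matter.
record LocalConstruction (d N : ℕ) (C : SimplicialComplex) : Set₁ where
  field
    k              : ℕ
    1≤N            : 1 ≤ N
    N≤k            : N ≤ k
    T              : ℕ → CellComplex
    pseudomanifold : ∀ i → 1 ≤ i → i ≤ k → IsPseudomanifold d (T i)
    start          : IsSimplex d (T 1)
    glue           : ∀ i → 1 ≤ i → i < N → Glue d (T i) (T (suc i))
    identify       : ∀ i → N ≤ i → i < k → Identify d (T i) (T (suc i))
    end            : IsFacePosetOf C (T k)

-- Purity of C is implied by that of T k.
record IsLC (d N : ℕ) (C : SimplicialComplex) : Set₁ where
  field
    facets       : HasFacets d N C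
    construction : LocalConstruction d N C

------------------------------------------------------------------------
-- Counting

-- The number of isomorphism classes of complexes satisfying P has the
-- (downward closed) property B.
CountUpToIso : (SimplicialComplex → Set₁) → (ℕ → Set) → Set₁
CountUpToIso P B =
  ∀ m (K : Fin m → SimplicialComplex) →
    (∀ i → P (K i)) →
    (∀ i j → i ≢ j → ¬ Isomorphic (K i) (K j)) →
    B m

-- m ≤ (d · (d/(d-1))^(d-1) · 2^((2d²-d)/3))^N for d ≥ 2, multiplied by
-- the denominator ((d-1)^(d-1))^N and then cubed.
Bound : ℕ → ℕ → ℕ → Set
Bound d N m =
  (m * ((d ∸ 1) ^ (d ∸ 1)) ^ N) ^ 3
    ≤ ((d * d ^ (d ∸ 1)) ^ 3 * 2 ^ (2 * d ^ 2 ∸ d)) ^ N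

{-# OPTIONS --safe #-}
module Submission where

-- A local construction is encoded by a word.  The tree of N simplices that
-- it starts from is properly (d+1)-coloured, and an identification of two
-- boundary facets along a common ridge is recorded by marking, in each of
-- the two facets, that ridge.  The marks determine the identifications: all
-- facets around a ridge are glued once the ridge has been used, so each
-- ridge of the final complex carries exactly the two marks of at most one
-- identification, and two marked ridges belong together as soon as their
-- vertices have been identified.
--
-- Of the dN+1 slots of the tree, N-1 carry a child, and each other one is
-- empty or carries one of d marks.  Painting each child in one of two
-- colours gives words of length dN+1 over d+3 letters, so there are at most
-- (d+3)^(dN+1) / 2^(N-1) codes.  Their growth rate (d+3)^d / 2 is strictly
-- smaller than that of the bound.

open import Defs
open import Data.Empty using (⊥-elim)
open import Data.Fin.Base using (Fin; zero; suc; punchIn; punchOut; combine; remQuot)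
open import Data.Fin.Permutation using (permutation)
open import Data.Fin.Properties as Fin using (_≟_; any?)
open import Data.Fin.Subset
open import Data.Fin.Subset.Properties
open import Data.List.Base as List using (List; []; _∷_; _++_; _∷ʳ_; length)
import Data.List.Properties as List
open import Data.Nat.Base as ℕ
  using (ℕ; zero; suc; _+_; _*_; _∸_; _^_; _≤_; _<_; z≤n; s≤s; NonZero)
import Data.Nat.Properties as ℕ
open import Data.Nat.Solver using (module +-*-Solver)
open import Data.Product using (∃; _×_; _,_; proj₁; proj₂; uncurry)
open import Data.Sum.Base using (_⊎_; inj₁; inj₂)
open import Data.Vec.Base as Vec
  using (Vec; []; _∷_; here; there; lookup; tabulate; updateAt; replicate; toList; fromList)
import Data.Vec.Properties as Vec
open import Function.Base using (_∘_; id)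
open import Function.Bundles using (mk⇔; module Equivalence)
open import Relation.Binary.Construct.Closure.Equivalence as Eq using (EqClosure)
open import Relation.Binary.Construct.Closure.ReflexiveTransitive as Star using (Star; ε; _◅_; _◅◅_)
open import Relation.Binary.Construct.Closure.Symmetric using (SymClosure; fwd; bwd)
open import Relation.Binary.Definitions using (tri<; tri≈; tri>)
open import Relation.Binary.Morphism.Structures using (module IsOrderMonomorphism)
open import Relation.Binary.PropositionalEquality
open import Relation.Binary.Structures using (module IsDecPartialOrder)
open import Relation.Nullary using (¬_; Dec; yes; no)
open import Relation.Nullary.Decidable using (_×-dec_; ¬?; decidable-stable; toWitness)

open CellComplex using (Cell; Rank; isDecPartialOrder)


-- Finite subsets

-- A code forgets the order of the identifications, so decoding cannot replay them. It uses instead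
-- `Same`, the least identification of corners closed under the marks. That `Same` reaches every
-- identification is carried through the steps one by one (`complete`); that it makes no others is
-- an induction on `Same` in the final complex, where `partner` says which marks belong together.
-- The obstacle is that a quotient map might identify faces of one simplex, or two simplices. This
-- is excluded from the far end: in the final complex the number of facets forces every simplex to
-- have d + 1 vertices of its own and the simplices to be distinct. These facts, and thinness, are
-- pulled back along the quotient maps to each stage. The painting matters at d = 2. The d + 2
-- letters of unpainted words give the growth rate (d + 2) ^ d = 16, exactly the base of the bound,
-- with no room for the constant factor d + 2 that the first slot brings; painted words give 5 ^ 2 /
-- 2 instead.

∈-─⁻ : ∀ {n} (p q : Subset n) {x} → x ∈ p ─ q → x ∉ q
∈-─⁻ (s ∷ p) (outside ∷ q) (there x∈) (there x∈q) = ∈-─⁻ p q x∈ x∈q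
∈-─⁻ (s ∷ p) (inside  ∷ q) (there x∈) (there x∈q) = ∈-─⁻ p q x∈ x∈q

∈-- : ∀ {n} (p : Subset n) (y : Fin n) {x} → x ∈ p - y → x ∈ p × x ≢ y
∈-- p y x∈ = p─q⊆p p ⁅ y ⁆ x∈ , λ where refl → ∈-─⁻ p ⁅ y ⁆ x∈ (x∈⁅x⁆ y)

suc∣p-x∣≡∣p∣ : ∀ {n} {p : Subset n} {x} → x ∈ p → suc ∣ p - x ∣ ≡ ∣ p ∣
suc∣p-x∣≡∣p∣ {p = inside ∷ p} {zero} here =
  cong (suc ∘ ∣_∣) (p─⊥≡p p)
suc∣p-x∣≡∣p∣ {p = inside ∷ p} {suc x} (there x∈) = cong suc (suc∣p-x∣≡∣p∣ x∈)
suc∣p-x∣≡∣p∣ {p = outside ∷ p} {suc x} (there x∈) = suc∣p-x∣≡∣p∣ x∈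

⊆∧≤⇒≡ : ∀ {n} {p q : Subset n} → p ⊆ q → ∣ q ∣ ≤ ∣ p ∣ → p ≡ q
⊆∧≤⇒≡ {p = p} {q} p⊆q ∣q∣≤∣p∣ = ⊆-antisym p⊆q λ {x} x∈q →
  decidable-stable (x ∈? p) λ x∉p →
    ℕ.<⇒≱ (p⊂q⇒∣p∣<∣q∣ (p⊆q , x , x∈q , x∉p)) ∣q∣≤∣p∣

⊆⇒≡- : ∀ {n} {p q : Subset n} → p ⊆ q → suc ∣ p ∣ ≡ ∣ q ∣ →
       ∃ λ x → x ∈ q × p ≡ q - x
⊆⇒≡- {p = p} {q} p⊆q eq with any? (λ x → (x ∈? q) ×-dec ¬? (x ∈? p))
... | yes (x , x∈q , x∉p) =
  x , x∈q , ⊆∧≤⇒≡ (λ {y} y∈p → x∈p∧x≢y⇒x∈p-y (p⊆q y∈p) λ where refl → x∉p y∈p)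
                  (ℕ.≤-reflexive (ℕ.suc-injective (trans (suc∣p-x∣≡∣p∣ x∈q) (sym eq))))
... | no none = ⊥-elim (ℕ.1+n≰n (ℕ.≤-trans (ℕ.≤-reflexive eq) (p⊆q⇒∣p∣≤∣q∣ q⊆p)))
  where
  q⊆p : q ⊆ p
  q⊆p {x} x∈q = decidable-stable (x ∈? p) λ x∉p → none (x , x∈q , x∉p)

-- A relation in place of a function allows an image to be found for the members of p only; that y
-- determines x serves as injectivity.
injection⇒∣∣≤ : ∀ {m n} (R : Fin m → Fin n → Set) (p : Subset m) (q : Subset n) →
                (∀ {x} → x ∈ p → ∃ λ y → y ∈ q × R x y) →
                (∀ {x x′ y} → R x y → R x′ y → x ≡ x′) →
                ∣ p ∣ ≤ ∣ q ∣
injection⇒∣∣≤ R [] q f inj = z≤n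
injection⇒∣∣≤ R (outside ∷ p) q f inj =
  injection⇒∣∣≤ (R ∘ suc) p q (f ∘ there) λ r r′ → Fin.suc-injective (inj r r′)
injection⇒∣∣≤ R (inside ∷ p) q f inj with f here
... | y , y∈q , r = ℕ.≤-trans
  (s≤s (injection⇒∣∣≤ (R ∘ suc) p (q - y) g λ r r′ → Fin.suc-injective (inj r r′)))
  (ℕ.≤-reflexive (suc∣p-x∣≡∣p∣ y∈q))
  where
  g : ∀ {x} → x ∈ p → ∃ λ z → z ∈ q - y × R (suc x) z
  g x∈p with f (there x∈p)
  ... | z , z∈q , r′ = z , x∈p∧x≢y⇒x∈p-y z∈q (λ where refl → Fin.0≢1+n (inj r r′)) , r′

injective⇒surjective : ∀ {n} (f : Fin n → Fin n) → (∀ {x y} → f x ≡ f y → x ≡ y) →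
                       ∀ y → ∃ λ x → f x ≡ y
injective⇒surjective {suc n} f inj y with any? (λ x → f x Fin.≟ y)
... | yes found = found
... | no none = ⊥-elim (ℕ.1+n≰n (Fin.injective⇒≤ {f = λ x → punchOut (y≢f x)}
                  λ {x} {x′} eq → inj (Fin.punchOut-injective (y≢f x) (y≢f x′) eq)))
  where
  y≢f : ∀ x → y ≢ f x
  y≢f x eq = none (x , sym eq)

facet : ∀ {n} → Fin n → Subset n
facet a = ⊤ - a

ridge : ∀ {n} → Fin n → Fin n → Subset n
ridge a b = ⊤ - a - b

∈facet⁺ : ∀ {n} {a x : Fin n} → x ≢ a → x ∈ facet a
∈facet⁺ = x∈p∧x≢y⇒x∈p-y ∈⊤

∈facet⁻ : ∀ {n} {a x : Fin n} → x ∈ facet a → x ≢ a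
∈facet⁻ {a = a} = proj₂ ∘ ∈-- ⊤ a

∈ridge⁺ : ∀ {n} {a b x : Fin n} → x ≢ a → x ≢ b → x ∈ ridge a b
∈ridge⁺ x≢a = x∈p∧x≢y⇒x∈p-y (∈facet⁺ x≢a)

∈ridge⁻ : ∀ {n} {a b x : Fin n} → x ∈ ridge a b → x ≢ a × x ≢ b
∈ridge⁻ {a = a} {b} x∈ = ∈facet⁻ (proj₁ (∈-- (facet a) b x∈)) , proj₂ (∈-- (facet a) b x∈)

ridge-comm : ∀ {n} (a b : Fin n) → ridge a b ≡ ridge b a
ridge-comm = p─x─y≡p─y─x ⊤

∣facet∣ : ∀ {n} (a : Fin (suc n)) → ∣ facet a ∣ ≡ n
∣facet∣ a = ℕ.suc-injective (trans (suc∣p-x∣≡∣p∣ (∈⊤ {x = a})) (∣⊤∣≡n _))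

suc∣ridge∣ : ∀ {n} {a b : Fin (suc n)} → a ≢ b → suc ∣ ridge a b ∣ ≡ n
suc∣ridge∣ {a = a} a≢b = trans (suc∣p-x∣≡∣p∣ (∈facet⁺ (a≢b ∘ sym))) (∣facet∣ a)

≡facet : ∀ {n} {p : Subset (suc n)} → ∣ p ∣ ≡ n → ∃ λ a → p ≡ facet a
≡facet {n} ∣p∣≡n with ⊆⇒≡- ⊆⊤ (trans (cong suc ∣p∣≡n) (sym (∣⊤∣≡n (suc n))))
... | a , _ , eq = a , eq

≡ridge : ∀ {n} {p : Subset (suc n)} {a} → p ⊆ facet a → suc ∣ p ∣ ≡ n →
         ∃ λ b → b ≢ a × p ≡ ridge a b
≡ridge {a = a} p⊆ eq with ⊆⇒≡- p⊆ (trans eq (sym (∣facet∣ a)))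
... | b , b∈ , p≡ = b , ∈facet⁻ b∈ , p≡

∉facet : ∀ {n} (a : Fin n) → a ∉ facet a
∉facet a a∈ = ∈facet⁻ a∈ refl

⁅⁆⊆ : ∀ {n} {x : Fin n} {p} → x ∈ p → ⁅ x ⁆ ⊆ p
⁅⁆⊆ {x = x} {p} x∈p y∈ = subst (_∈ p) (sym (x∈⁅y⁆⇒x≡y x y∈)) x∈p

-- Walks in a graph of degree at most two

HalfStep : {H : Set} (s : H → H) (G : H → H → Set) → H → H → Set
HalfStep s G h h′ = s h ≡ h′ ⊎ G h h′

-- A graph in which every node has the two ends h and s h, and in which
-- every end is glued to at most one other end, is a union of paths and
-- cycles; so the component of a free end h₀ is exhausted by walking from it.
module Walk {H : Set} (s : H → H) (s-involutive : ∀ h → s (s h) ≡ h)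
            (G : H → H → Set) (G-sym : ∀ {h h′} → G h h′ → G h′ h)
            (G-functional : ∀ {h h′ h″} → G h h′ → G h h″ → h′ ≡ h″) where

  Glued : H → Set
  Glued h = ∃ (G h)

  -- The n-th node of the walk from h₀ is entered at its end h and left through `s h`.
  data Entered (h₀ : H) : ℕ → H → Set where
    start : Entered h₀ 0 h₀
    step  : ∀ {n h h′} → Entered h₀ n h → G (s h) h′ → Entered h₀ (suc n) h′

  Visited : H → H → Set
  Visited h₀ h = ∃ λ n → Entered h₀ n h ⊎ Entered h₀ n (s h)

  entered-unique : ∀ {h₀ n h h′} → Entered h₀ n h → Entered h₀ n h′ → h ≡ h′
  entered-unique start start = refl
  entered-unique (step e g) (step e′ g′)
    rewrite entered-unique e e′ = G-functional g g′

  entered-before : ∀ {h₀ m n h} → Entered h₀ n h → m < n →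
                   ∃ λ h′ → Entered h₀ m h′ × Glued (s h′)
  entered-before {m = m} {suc n} (step {h = h} e g) (s≤s m≤n) with ℕ.m≤n⇒m<n∨m≡n m≤n
  ... | inj₁ m<n = entered-before e m<n
  ... | inj₂ refl = h , e , _ , g

  -- A swap stays at the node. Glueing at the exit advances the walk; glueing at the entrance leads
  -- back to the previous node, and at the start of the walk it is excluded because h₀ is free.
  visited-step : ∀ {h₀ h h′} → ¬ Glued h₀ → Visited h₀ h → HalfStep s G h h′ → Visited h₀ h′
  visited-step free (n , inj₁ e) (inj₁ refl) = n , inj₂ (subst (Entered _ n) (sym (s-involutive _)) e)
  visited-step free (n , inj₂ e) (inj₁ refl) = n , inj₁ e
  visited-step free (zero , inj₁ start) (inj₂ g) = ⊥-elim (free (_ , g))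
  visited-step free (suc n , inj₁ (step e g′)) (inj₂ g)
    rewrite G-functional g (G-sym g′) = n , inj₂ (subst (Entered _ n) (sym (s-involutive _)) e)
  visited-step {h = h} free (n , inj₂ e) (inj₂ g) =
    suc n , inj₁ (step e (subst (λ x → G x _) (sym (s-involutive h)) g))

  visited-star : ∀ {h₀ h h′} → ¬ Glued h₀ → Visited h₀ h → Star (HalfStep s G) h h′ → Visited h₀ h′
  visited-star free v ε = v
  visited-star free v (x ◅ xs) = visited-star free (visited-step free v x) xs

  -- Being free and different from h₀, h₁ is the exit of some n-th node, where the walk stops. An
  -- entrance is h₀ or is glued backwards; the exit of the m-th node is glued if m < n, is h₁ if m =
  -- n, and m > n would require leaving through h₁.
  two-ends : ∀ {h₀ h₁ h} → ¬ Glued h₀ → ¬ Glued h₁ → h₀ ≢ h₁ →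
             Star (HalfStep s G) h₀ h₁ → Star (HalfStep s G) h₀ h → h ≡ h₀ ⊎ h ≡ h₁ ⊎ Glued h
  two-ends {h₀} {h₁} {h} free₀ free₁ h₀≢h₁ c₁ c
    with visited-star free₀ (0 , inj₁ start) c₁ | visited-star free₀ (0 , inj₁ start) c
  ... | zero , inj₁ start | _ = ⊥-elim (h₀≢h₁ refl)
  ... | suc n , inj₁ (step e g) | _ = ⊥-elim (free₁ (_ , G-sym g))
  ... | n , inj₂ e₁ | zero , inj₁ start = inj₁ refl
  ... | n , inj₂ e₁ | suc m , inj₁ (step e g) = inj₂ (inj₂ (_ , G-sym g))
  ... | n , inj₂ e₁ | m , inj₂ e with ℕ.<-cmp m n
  ...   | tri≈ _ refl _ = inj₂ (inj₁ (trans (sym (s-involutive h))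
                            (trans (cong s (entered-unique e e₁)) (s-involutive h₁))))
  ...   | tri< m<n _ _ with entered-before e₁ m<n
  ...     | h′ , e′ , glued rewrite entered-unique e′ e =
              inj₂ (inj₂ (subst Glued (s-involutive h) glued))
  two-ends {h₀} {h₁} {h} free₀ free₁ h₀≢h₁ c₁ c
      | n , inj₂ e₁ | m , inj₂ e | tri> _ _ n<m with entered-before e n<m
  ...     | h′ , e′ , glued rewrite entered-unique e′ e₁ =
              ⊥-elim (free₁ (subst Glued (s-involutive h₁) glued))

-- Codes

-- A tree of d-simplices whose boundary facets may be marked by one of
-- their d ridges.  Colouring the vertices of the root by Fin (suc d) and
-- letting a new vertex inherit the colour of the vertex opposite to the
-- glued facet, simplices are addressed by words of facet colours from the
-- root.  The slots of a non-root simplex are its facets except the one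
-- shared with its parent.
data Slot (d : ℕ) : Set where
  none  : Slot d
  mark  : Fin d → Slot d
  child : Vec (Slot d) d → Slot d

Code : ℕ → Set
Code d = Vec (Slot d) (suc d)

Word : ℕ → Set
Word d = List (Fin (suc d))

-- The kind `void` is that of addresses outside the tree, including those that step back across the
-- facet shared with the parent.
data Kind (d : ℕ) : Set where
  void none child : Kind d
  mark            : Fin d → Kind d

module _ {d : ℕ} where

  leaf : Slot d
  leaf = child (replicate d none)

  kind : Slot d → Kind d
  kind none      = none
  kind (mark m)  = mark m
  kind (child t) = child

  -- The colour argument is that of the facet which the slot represents.
  slotKind : Fin (suc d) → Slot d → Word d → Kind d
  slotKind c s [] = kind s
  slotKind c none (a ∷ w) = void
  slotKind c (mark m) (a ∷ w) = void
  slotKind c (child t) (a ∷ w) with c ≟ a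
  ... | yes _   = void
  ... | no  c≢a = slotKind a (lookup t (punchOut c≢a)) w

  kindAt : Code d → Word d → Kind d
  kindAt r []      = child
  kindAt r (a ∷ w) = slotKind a (lookup r a) w

  -- Filling an empty slot

  putSlot : Slot d → Fin (suc d) → Slot d → Word d → Slot d
  putSlot s′ c s [] = s′
  putSlot s′ c none (a ∷ w) = none
  putSlot s′ c (mark m) (a ∷ w) = mark m
  putSlot s′ c (child t) (a ∷ w) with c ≟ a
  ... | yes _   = child t
  ... | no  c≢a = child (updateAt t (punchOut c≢a) λ s → putSlot s′ a s w)

  put : Code d → Word d → Slot d → Code d
  put r []      s′ = r
  put r (a ∷ w) s′ = updateAt r a λ s → putSlot s′ a s w

  slotKind-put : ∀ s′ c s w → slotKind c s w ≡ none →
                 slotKind c (putSlot s′ c s w) w ≡ kind s′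
  slotKind-put s′ c s [] eq = refl
  slotKind-put s′ c (child t) (a ∷ w) eq with c ≟ a in c≟a
  ... | no c≢a rewrite c≟a
                     | Vec.lookup∘updateAt (punchOut c≢a) {f = λ s → putSlot s′ a s w} t =
    slotKind-put s′ a _ w eq

  kindAt-put : ∀ s′ r w → kindAt r w ≡ none → kindAt (put r w s′) w ≡ kind s′
  kindAt-put s′ r (a ∷ w) eq
    rewrite Vec.lookup∘updateAt a {f = λ s → putSlot s′ a s w} r = slotKind-put s′ a _ w eq

  -- Void addresses are excluded because those below w come into existence when a child is placed at
  -- w.
  slotKind-put-≢ : ∀ s′ c s w v → slotKind c s w ≡ none → slotKind c s v ≢ void →
                   v ≢ w → slotKind c (putSlot s′ c s w) v ≡ slotKind c s v
  slotKind-put-≢ s′ c s [] [] eq nv v≢w = ⊥-elim (v≢w refl)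
  slotKind-put-≢ s′ c none [] (e ∷ v) eq nv v≢w = ⊥-elim (nv refl)
  slotKind-put-≢ s′ c (child t) (a ∷ w) [] eq nv v≢w with c ≟ a
  ... | no c≢a = refl
  slotKind-put-≢ s′ c (child t) (a ∷ w) (e ∷ v) eq nv v≢w with e ≟ a
  slotKind-put-≢ s′ c (child t) (a ∷ w) (a ∷ v) eq nv v≢w | yes refl with c ≟ a in c≟a
  ... | no c≢a rewrite c≟a
                     | Vec.lookup∘updateAt (punchOut c≢a) {f = λ s → putSlot s′ a s w} t =
        slotKind-put-≢ s′ a _ w v eq nv (v≢w ∘ cong (a ∷_))
  slotKind-put-≢ s′ c (child t) (a ∷ w) (e ∷ v) eq nv v≢w | no e≢a with c ≟ a
  ... | no c≢a with c ≟ e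
  ...   | yes _ = refl
  ...   | no c≢e
          rewrite Vec.lookup∘updateAt′ (punchOut c≢e) (punchOut c≢a) {f = λ s → putSlot s′ a s w}
                    (e≢a ∘ Fin.punchOut-injective c≢e c≢a) t = refl

  kindAt-put-≢ : ∀ s′ r w v → kindAt r w ≡ none → kindAt r v ≢ void →
                 v ≢ w → kindAt (put r w s′) v ≡ kindAt r v
  kindAt-put-≢ s′ r (a ∷ w) [] eq nv v≢w = refl
  kindAt-put-≢ s′ r (a ∷ w) (e ∷ v) eq nv v≢w with e ≟ a
  ... | yes refl rewrite Vec.lookup∘updateAt a {f = λ s → putSlot s′ a s w} r =
        slotKind-put-≢ s′ a _ w v eq nv (v≢w ∘ cong (a ∷_))
  ... | no e≢a rewrite Vec.lookup∘updateAt′ e a {f = λ s → putSlot s′ a s w} e≢a r = refl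

  data Filled : Kind d → Set where
    child : Filled child
    mark  : ∀ {m} → Filled (mark m)

  Flat : Slot d → Set
  Flat s = ∀ c a w → ¬ Filled (slotKind c s (a ∷ w))

  mark-flat : ∀ m → Flat (mark m)
  mark-flat m c a w ()

  none-flat : ∀ a w → ¬ Filled (slotKind a none w)
  none-flat a [] ()
  none-flat a (_ ∷ _) ()

  leaf-flat : Flat leaf
  leaf-flat c a w f with c ≟ a
  ... | no c≢a =
    none-flat a w (subst (λ s → Filled (slotKind a s w)) (Vec.lookup-replicate (punchOut c≢a) none) f)

  -- Flatness leaves nothing filled strictly below w, so a filled address other than w lies in an
  -- untouched part of the tree.
  slotKind-put⁻ : ∀ s′ → Flat s′ → ∀ c s w v → slotKind c s w ≡ none →
                  Filled (slotKind c (putSlot s′ c s w) v) →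
                  v ≡ w ⊎ slotKind c (putSlot s′ c s w) v ≡ slotKind c s v
  slotKind-put⁻ s′ fl c s [] [] eq f = inj₁ refl
  slotKind-put⁻ s′ fl c s [] (e ∷ v) eq f = ⊥-elim (fl c e v f)
  slotKind-put⁻ s′ fl c (child t) (a ∷ w) [] eq f with c ≟ a
  ... | no c≢a = inj₂ refl
  slotKind-put⁻ s′ fl c (child t) (a ∷ w) (e ∷ v) eq f with e ≟ a
  slotKind-put⁻ s′ fl c (child t) (a ∷ w) (a ∷ v) eq f | yes refl with c ≟ a in c≟a
  ... | no c≢a rewrite c≟a
                     | Vec.lookup∘updateAt (punchOut c≢a) {f = λ s → putSlot s′ a s w} t
        with slotKind-put⁻ s′ fl a _ w v eq f
  ...   | inj₁ refl = inj₁ refl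
  ...   | inj₂ eq′ = inj₂ eq′
  slotKind-put⁻ s′ fl c (child t) (a ∷ w) (e ∷ v) eq f | no e≢a with c ≟ a
  ... | no c≢a with c ≟ e
  ...   | yes _ = inj₂ refl
  ...   | no c≢e
          rewrite Vec.lookup∘updateAt′ (punchOut c≢e) (punchOut c≢a) {f = λ s → putSlot s′ a s w}
                    (e≢a ∘ Fin.punchOut-injective c≢e c≢a) t = inj₂ refl

  kindAt-put⁻ : ∀ s′ → Flat s′ → ∀ r w v → kindAt r w ≡ none →
                Filled (kindAt (put r w s′) v) →
                v ≡ w ⊎ kindAt (put r w s′) v ≡ kindAt r v
  kindAt-put⁻ s′ fl r (a ∷ w) [] eq f = inj₂ refl
  kindAt-put⁻ s′ fl r (a ∷ w) (e ∷ v) eq f with e ≟ a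
  ... | no e≢a rewrite Vec.lookup∘updateAt′ e a {f = λ s → putSlot s′ a s w} e≢a r = inj₂ refl
  ... | yes refl rewrite Vec.lookup∘updateAt a {f = λ s → putSlot s′ a s w} r
            with slotKind-put⁻ s′ fl a _ w v eq f
  ...       | inj₁ refl = inj₁ refl
  ...       | inj₂ eq′ = inj₂ eq′

  -- A simplex has a slot for each of its facets except the one towards its parent, and the colour
  -- of that one is the last letter of its address.
  slotKind-void : ∀ c s w a → slotKind c s w ≡ child → slotKind c s (w ∷ʳ a) ≡ void →
                  ∃ λ v → c ∷ w ≡ v ∷ʳ a
  slotKind-void c (child t) [] a eq vd with c ≟ a
  ... | yes refl = [] , refl
  ... | no c≢a with lookup t (punchOut c≢a) | vd
  ...   | none | ()
  ...   | mark _ | ()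
  ...   | child _ | ()
  slotKind-void c (child t) (e ∷ w) a eq vd with c ≟ e
  ... | no c≢e with slotKind-void e (lookup t (punchOut c≢e)) w a eq vd
  ...   | v , eq′ = c ∷ v , cong (c ∷_) eq′

  kindAt-void : ∀ r w a → kindAt r w ≡ child → kindAt r (w ∷ʳ a) ≡ void →
                ∃ λ v → w ≡ v ∷ʳ a
  kindAt-void r [] a eq vd with lookup r a | vd
  ... | none | ()
  ... | mark _ | ()
  ... | child _ | ()
  kindAt-void r (c ∷ w) a eq vd = slotKind-void c (lookup r c) w a eq vd

  slotKind-parent : ∀ c s w a → Filled (slotKind c s (w ∷ʳ a)) → slotKind c s w ≡ child
  slotKind-parent c (child t) [] a f = refl
  slotKind-parent c (child t) (e ∷ w) a f with c ≟ e
  ... | no c≢e = slotKind-parent e (lookup t (punchOut c≢e)) w a f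

  kindAt-parent : ∀ r w a → Filled (kindAt r (w ∷ʳ a)) → kindAt r w ≡ child
  kindAt-parent r [] a f = refl
  kindAt-parent r (c ∷ w) a f = slotKind-parent c (lookup r c) w a f

  -- Number of simplices and serialization of a code

  children : ∀ {n} → Vec (Slot d) n → ℕ
  children [] = 0
  children (none ∷ r) = children r
  children (mark _ ∷ r) = children r
  children (child t ∷ r) = suc (children t + children r)

  childrenˢ : Slot d → ℕ
  childrenˢ s = children (s ∷ [])

  children-∷ : ∀ {n} s (r : Vec (Slot d) n) → children (s ∷ r) ≡ childrenˢ s + children r
  children-∷ none r = refl
  children-∷ (mark _) r = refl
  children-∷ (child t) r rewrite ℕ.+-identityʳ (children t) = refl

  children-updateAt : ∀ {n} k (r : Vec (Slot d) n) i f →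
                      childrenˢ (f (lookup r i)) ≡ k + childrenˢ (lookup r i) →
                      children (updateAt r i f) ≡ k + children r
  children-updateAt k (s ∷ r) zero f eq
    rewrite children-∷ (f s) r | children-∷ s r | eq = ℕ.+-assoc k _ _
  children-updateAt k (s ∷ r) (suc i) f eq
    rewrite children-∷ s (updateAt r i f) | children-∷ s r
          | children-updateAt k r i f eq =
    solve 3 (λ x y z → x :+ (y :+ z) := y :+ (x :+ z)) refl (childrenˢ s) k (children r)
    where open +-*-Solver

  children-putSlot : ∀ s′ c s w → slotKind c s w ≡ none →
                     childrenˢ (putSlot s′ c s w) ≡ childrenˢ s′ + childrenˢ s
  children-putSlot s′ c none [] eq = sym (ℕ.+-identityʳ _)
  children-putSlot s′ c (child t) (a ∷ w) eq with c ≟ a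
  ... | no c≢a =
    trans (cong (λ x → suc (x + 0)) (children-updateAt (childrenˢ s′) t (punchOut c≢a) _
                                       (children-putSlot s′ a _ w eq)))
          (solve 2 (λ x y → con 1 :+ (x :+ y :+ con 0) := x :+ (con 1 :+ (y :+ con 0)))
             refl (childrenˢ s′) (children t))
        where open +-*-Solver

  children-put : ∀ s′ r w → kindAt r w ≡ none →
                 children (put r w s′) ≡ childrenˢ s′ + children r
  children-put s′ r (a ∷ w) eq =
    children-updateAt (childrenˢ s′) r a _ (children-putSlot s′ a _ w eq)

  children-none : ∀ n → children (replicate n none) ≡ 0
  children-none zero    = refl
  children-none (suc n) = children-none n

  childrenˢ-leaf : childrenˢ leaf ≡ 1
  childrenˢ-leaf = cong suc (trans (ℕ.+-identityʳ _) (children-none d))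

  -- The slots in depth-first order, with the letters 0 for none, 1 for
  -- child and 2 + m for mark m.
  serialize : ∀ {n} → Vec (Slot d) n → List (Fin (2 + d))
  serialize [] = []
  serialize (none    ∷ r) = zero ∷ serialize r
  serialize (mark m  ∷ r) = suc (suc m) ∷ serialize r
  serialize (child t ∷ r) = suc zero ∷ serialize t ++ serialize r

  -- The length n tells how many slots remain to be read, so serializations are prefix-free; the
  -- trailing words u and u′ carry this through the nested children.
  serialize-injective : ∀ {n} (r r′ : Vec (Slot d) n) {u u′} →
                        serialize r ++ u ≡ serialize r′ ++ u′ → r ≡ r′ × u ≡ u′
  serialize-injective [] [] eq = refl , eq
  serialize-injective (none ∷ r) (none ∷ r′) eq
    with serialize-injective r r′ (List.∷-injectiveʳ eq)
  ... | refl , eq′ = refl , eq′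
  serialize-injective (mark m ∷ r) (mark m′ ∷ r′) eq
    with List.∷-injectiveˡ eq | serialize-injective r r′ (List.∷-injectiveʳ eq)
  ... | refl | refl , eq′ = refl , eq′
  serialize-injective (child t ∷ r) (child t′ ∷ r′) {u} {u′} eq
    with serialize-injective t t′ {serialize r ++ u} {serialize r′ ++ u′}
           (trans (sym (List.++-assoc (serialize t) _ _))
             (trans (List.∷-injectiveʳ eq) (List.++-assoc (serialize t′) _ _)))
  ... | refl , eq′ with serialize-injective r r′ eq′
  ...   | refl , eq″ = refl , eq″

  -- Each child opens d further slots.
  length-serialize : ∀ {n} (r : Vec (Slot d) n) → length (serialize r) ≡ n + d * children r
  length-serialize [] = sym (ℕ.*-zeroʳ d)
  length-serialize (none ∷ r) = cong suc (length-serialize r)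
  length-serialize (mark _ ∷ r) = cong suc (length-serialize r)
  length-serialize {suc n} (child t ∷ r)
    rewrite List.length-++ (serialize t) {serialize r} | length-serialize t | length-serialize r =
    cong suc (solve 4 (λ d x n y → d :+ d :* x :+ (n :+ d :* y) :=
                                   n :+ d :* (con 1 :+ (x :+ y)))
                refl d (children t) n (children r))
    where open +-*-Solver

  childSymbols : List (Fin (2 + d)) → ℕ
  childSymbols [] = 0
  childSymbols (zero ∷ u) = childSymbols u
  childSymbols (suc zero ∷ u) = suc (childSymbols u)
  childSymbols (suc (suc _) ∷ u) = childSymbols u

  childSymbols-serialize : ∀ {n} (r : Vec (Slot d) n) u →
    childSymbols (serialize r ++ u) ≡ children r + childSymbols u
  childSymbols-serialize [] u = refl
  childSymbols-serialize (none ∷ r) u = childSymbols-serialize r u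
  childSymbols-serialize (mark _ ∷ r) u = childSymbols-serialize r u
  childSymbols-serialize (child t ∷ r) u
    rewrite List.++-assoc (serialize t) (serialize r) u
          | childSymbols-serialize t (serialize r ++ u)
          | childSymbols-serialize r u = cong suc (sym (ℕ.+-assoc (children t) _ _))

-- Boolean intervals

_∋_⊑_ : (T : CellComplex) → Cell T → Cell T → Set
T ∋ G ⊑ H = CellComplex._⊑_ T G H

module _ (T : CellComplex) where
  open IsDecPartialOrder (isDecPartialOrder T)
    using () public
    renaming (refl to ⊑-refl; reflexive to ⊑-reflexive; trans to ⊑-trans; antisym to ⊑-antisym)

-- The data of a chart of the cell `χ ⊤`, with downward closedness stated at every face instead of
-- only at the top.
record Embedding (T : CellComplex) {n} (χ : Subset n → Cell T) : Set where
  field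
    mono     : ∀ {S U} → S ⊆ U → T ∋ χ S ⊑ χ U
    reflects : ∀ {S U} → T ∋ χ S ⊑ χ U → S ⊆ U
    lower    : ∀ {G S} → T ∋ G ⊑ χ S → ∃ λ U → U ⊆ S × χ U ≡ G

  injective : ∀ {S U} → χ S ≡ χ U → S ≡ U
  injective eq = ⊆-antisym (reflects (⊑-reflexive T eq)) (reflects (⊑-reflexive T (sym eq)))

module ChartProperties (T : CellComplex) {r} {F : Cell T} (c : Rank T r F) where
  open Chart c
  open IsOrderMonomorphism isOrderMonomorphism using (cancel) renaming (mono to mono′)

  below : ∀ {G} → T ∋ G ⊑ F → ∃ λ S → cell S ≡ G
  below = Equivalence.to (image _)

  cell⊑ : ∀ S → T ∋ cell S ⊑ F
  cell⊑ S = Equivalence.from (image _) (S , refl)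

  embedding : Embedding T cell
  embedding = record
    { mono     = λ S⊆U → mono′ S⊆U
    ; reflects = λ le → cancel le
    ; lower    = λ {G} {S} le →
        let U , eq = below (⊑-trans T le (cell⊑ S))
        in U , cancel (subst (T ∋_⊑ cell S) (sym eq) le) , eq
    }

  top : cell ⊤ ≡ F
  top with below (⊑-refl T)
  ... | S , eq = ⊑-antisym T (cell⊑ ⊤) (subst (T ∋_⊑ cell ⊤) eq (mono′ {S} ⊆⊤))

module _ {T : CellComplex} where

  -- The number of vertices is the length of the longest chains below a cell: deleting a vertex of S
  -- gives a strictly smaller cell, hence a proper subset U′ of U.
  ∣∣-mono-cells : ∀ k {m n} {χ : Subset m → Cell T} {ψ : Subset n → Cell T} →
                  Embedding T χ → Embedding T ψ →
                  ∀ {S U} → χ S ≡ ψ U → k ≤ ∣ S ∣ → k ≤ ∣ U ∣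
  ∣∣-mono-cells zero Eχ Eψ eq k≤ = z≤n
  ∣∣-mono-cells (suc k) {m} {χ = χ} {ψ} Eχ Eψ {S} {U} eq k≤ with nonempty? S
  ... | no empty rewrite Empty-unique empty | ∣⊥∣≡0 m = ⊥-elim (ℕ.n≮0 k≤)
  ... | yes (x , x∈S) with Embedding.lower Eψ
          (subst (T ∋ χ (S - x) ⊑_) eq (Embedding.mono Eχ (p─q⊆p S ⁅ x ⁆)))
  ...   | U′ , U′⊆U , eq′ =
          ℕ.≤-<-trans
            (∣∣-mono-cells k Eχ Eψ (sym eq′)
              (ℕ.s≤s⁻¹ (subst (suc k ≤_) (sym (suc∣p-x∣≡∣p∣ x∈S)) k≤)))
            (ℕ.≰⇒> λ ∣U∣≤∣U′∣ →
              proj₂ (∈-- S x (subst (x ∈_)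
                (sym (Embedding.injective Eχ (trans (sym eq′)
                  (trans (cong ψ (⊆∧≤⇒≡ U′⊆U ∣U∣≤∣U′∣)) (sym eq))))) x∈S)) refl)

  ∣∣-unique : ∀ {m n} {χ : Subset m → Cell T} {ψ : Subset n → Cell T} →
              Embedding T χ → Embedding T ψ → ∀ {S U} → χ S ≡ ψ U → ∣ S ∣ ≡ ∣ U ∣
  ∣∣-unique Eχ Eψ eq = ℕ.≤-antisym (∣∣-mono-cells _ Eχ Eψ eq ℕ.≤-refl)
                                   (∣∣-mono-cells _ Eψ Eχ (sym eq) ℕ.≤-refl)

  rank≡∣∣ : ∀ {n r} {χ : Subset n → Cell T} → Embedding T χ →
            ∀ {S} → Rank T r (χ S) → ∣ S ∣ ≡ r
  rank≡∣∣ {r = r} E c =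
    trans (∣∣-unique E (ChartProperties.embedding T c) (sym (ChartProperties.top T c))) (∣⊤∣≡n r)

  -- No chart has to be built: the complex supplies one of some rank, and counting vertices forces
  -- that rank to be r.
  rank : ∀ {n r} {χ : Subset n → Cell T} → Embedding T χ → ∀ {S} → ∣ S ∣ ≡ r → Rank T r (χ S)
  rank {χ = χ} E {S} refl with CellComplex.simplicial T (χ S)
  ... | r , c rewrite rank≡∣∣ E c = c

  rank-⊑ : ∀ {r F G} → Rank T r F → Rank T r G → T ∋ F ⊑ G → F ≡ G
  rank-⊑ {r} cF cG F⊑G with ChartProperties.below T cG F⊑G
  ... | U , refl = trans (cong (Chart.cell cG)
                           (∣p∣≡n⇒p≡⊤ (rank≡∣∣ (ChartProperties.embedding T cG) cF)))
                         (ChartProperties.top T cG)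

  -- Relabel the vertices of the simplex ν so that its facet shared with ψ
  -- keeps the labels of ψ, its remaining vertex being labelled a.
  module Extend {n} {ψ ν : Subset (suc n) → Cell T} (Eψ : Embedding T ψ) (Eν : Embedding T ν)
                (a : Fin (suc n)) {U₀ : Subset (suc n)} (shared : ψ (facet a) ≡ ν U₀) where

    private
      module ψ = Embedding Eψ
      module ν = Embedding Eν

      below : ∀ S → ∃ λ U → U ⊆ U₀ × ν U ≡ ψ (S - a)
      below S = ν.lower (subst (T ∋ ψ (S - a) ⊑_) shared
        (ψ.mono λ x∈ → ∈facet⁺ (proj₂ (∈-- S a x∈))))

      κ : Subset (suc n) → Subset (suc n)
      κ S = proj₁ (below S)

      ν-κ : ∀ S → ν (κ S) ≡ ψ (S - a)
      ν-κ S = proj₂ (proj₂ (below S))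

      apex : ∃ λ p → U₀ ≡ facet p
      apex = ≡facet (trans (sym (∣∣-unique Eψ Eν shared)) (∣facet∣ a))

      p = proj₁ apex

      p∉κ : ∀ S → p ∉ κ S
      p∉κ S p∈ = ∈facet⁻ (subst (p ∈_) (proj₂ apex) (proj₁ (proj₂ (below S)) p∈)) refl

      κ-mono : ∀ {S S′} → S - a ⊆ S′ - a → κ S ⊆ κ S′
      κ-mono {S} {S′} le = ν.reflects
        (subst₂ (T ∋_⊑_) (sym (ν-κ S)) (sym (ν-κ S′)) (ψ.mono le))

      κ-reflects : ∀ {S S′} → κ S ⊆ κ S′ → S - a ⊆ S′ - a
      κ-reflects {S} {S′} le = ψ.reflects
        (subst₂ (T ∋_⊑_) (ν-κ S) (ν-κ S′) (ν.mono le))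

      -- The change of labels is a map of subsets because `κ`, which translates the labels of the
      -- shared facet, is known only through cells; the colour a is sent to the remaining vertex p
      -- of ν.
      Π : Subset (suc n) → Subset (suc n)
      Π S with a ∈? S
      ... | yes _ = κ S ∪ ⁅ p ⁆
      ... | no  _ = κ S

      Π⁺ : ∀ {S x} → x ∈ κ S ⊎ (x ≡ p × a ∈ S) → x ∈ Π S
      Π⁺ {S} h with a ∈? S
      Π⁺ (inj₁ x∈)          | yes _ = x∈p∪q⁺ (inj₁ x∈)
      Π⁺ (inj₂ (refl , _))  | yes _ = x∈p∪q⁺ (inj₂ (x∈⁅x⁆ p))
      Π⁺ (inj₁ x∈)          | no _  = x∈
      Π⁺ (inj₂ (_ , a∈))    | no a∉ = ⊥-elim (a∉ a∈)

      Π⁻ : ∀ {S x} → x ∈ Π S → x ∈ κ S ⊎ (x ≡ p × a ∈ S)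
      Π⁻ {S} x∈ with a ∈? S
      ... | no _ = inj₁ x∈
      ... | yes a∈ with x∈p∪q⁻ (κ S) ⁅ p ⁆ x∈
      ...   | inj₁ x∈κ = inj₁ x∈κ
      ...   | inj₂ x∈p = inj₂ (x∈⁅y⁆⇒x≡y p x∈p , a∈)

      Π-mono : ∀ {S S′} → S ⊆ S′ → Π S ⊆ Π S′
      Π-mono {S} {S′} le x∈ with Π⁻ x∈
      ... | inj₁ x∈κ = Π⁺ (inj₁ (κ-mono (λ y∈ →
                         let y∈S , y≢a = ∈-- S a y∈ in x∈p∧x≢y⇒x∈p-y (le y∈S) y≢a) x∈κ))
      ... | inj₂ (eq , a∈) = Π⁺ (inj₂ (eq , le a∈))

      Π-reflects : ∀ {S S′} → Π S ⊆ Π S′ → S ⊆ S′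
      Π-reflects {S} {S′} le {y} y∈S with y ≟ a
      ... | yes refl with Π⁻ (le (Π⁺ (inj₂ (refl , y∈S))))
      ...   | inj₁ p∈ = ⊥-elim (p∉κ S′ p∈)
      ...   | inj₂ (_ , a∈) = a∈
      Π-reflects {S} {S′} le {y} y∈S | no y≢a =
        proj₁ (∈-- S′ a (κ-reflects κ⊆κ (x∈p∧x≢y⇒x∈p-y y∈S y≢a)))
        where
        κ⊆κ : κ S ⊆ κ S′
        κ⊆κ x∈ with Π⁻ (le (Π⁺ (inj₁ x∈)))
        ... | inj₁ x∈′ = x∈′
        ... | inj₂ (refl , _) = ⊥-elim (p∉κ S x∈)

      -a-unchanged : ∀ {S} → a ∉ S → S - a ≡ S
      -a-unchanged {S} a∉ = ⊆-antisym (p─q⊆p S ⁅ a ⁆)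
        λ x∈ → x∈p∧x≢y⇒x∈p-y x∈ λ where refl → a∉ x∈

      Π-≡ : ∀ {S U} → κ S ≡ U - p → (a ∈ S → p ∈ U) → (p ∈ U → a ∈ S) → Π S ≡ U
      Π-≡ {S} {U} eq to from = ⊆-antisym incl incl′
        where
        incl : Π S ⊆ U
        incl x∈ with Π⁻ x∈
        ... | inj₁ x∈κ = proj₁ (∈-- U p (subst (_ ∈_) eq x∈κ))
        ... | inj₂ (refl , a∈) = to a∈
        incl′ : U ⊆ Π S
        incl′ {x} x∈ with x ≟ p
        ... | yes refl = Π⁺ (inj₂ (refl , from x∈))
        ... | no x≢p = Π⁺ (inj₁ (subst (x ∈_) (sym eq) (x∈p∧x≢y⇒x∈p-y x∈ x≢p)))

      Π-surjective : ∀ U → ∃ λ S → Π S ≡ U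
      Π-surjective U with ψ.lower {ν (U - p)} {facet a} (subst (T ∋ ν (U - p) ⊑_) (sym shared)
        (ν.mono (λ x∈ → subst (_ ∈_) (sym (proj₂ apex)) (∈facet⁺ (proj₂ (∈-- U p x∈))))))
      ... | S₀ , S₀⊆ , eq with p ∈? U
      ...   | no p∉ = S₀ , Π-≡ (ν.injective (trans (ν-κ S₀) (trans (cong ψ (-a-unchanged a∉)) eq)))
                         (⊥-elim ∘ a∉) (⊥-elim ∘ p∉)
        where
        a∉ : a ∉ S₀
        a∉ a∈ = ∉facet a (S₀⊆ a∈)
      ...   | yes p∈ = S₀ ∪ ⁅ a ⁆ , Π-≡ (ν.injective (trans (ν-κ _) (trans (cong ψ same) eq)))
                         (λ _ → p∈) (λ _ → x∈p∪q⁺ (inj₂ (x∈⁅x⁆ a)))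
        where
        same : S₀ ∪ ⁅ a ⁆ - a ≡ S₀
        same = ⊆-antisym (λ x∈ → go x∈ (∈-- (S₀ ∪ ⁅ a ⁆) a x∈))
          λ x∈ → x∈p∧x≢y⇒x∈p-y (x∈p∪q⁺ (inj₁ x∈)) (∈facet⁻ (S₀⊆ x∈))
          where
          go : ∀ {x} → x ∈ S₀ ∪ ⁅ a ⁆ - a → x ∈ S₀ ∪ ⁅ a ⁆ × x ≢ a → x ∈ S₀
          go _ (x∈ , x≢a) with x∈p∪q⁻ S₀ ⁅ a ⁆ x∈
          ... | inj₁ x∈S₀ = x∈S₀
          ... | inj₂ x∈a = ⊥-elim (x≢a (x∈⁅y⁆⇒x≡y a x∈a))

    extended : Subset (suc n) → Cell T
    extended S = ν (Π S)

    extended-onto : ∀ U → ∃ λ S → extended S ≡ ν U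
    extended-onto U = let S , eq = Π-surjective U in S , cong ν eq

    extended-embedding : Embedding T extended
    extended-embedding = record
      { mono     = λ le → ν.mono (Π-mono le)
      ; reflects = λ le → Π-reflects (ν.reflects le)
      ; lower    = λ {G} {S} le →
          let U , U⊆ , eq = ν.lower le
              S′ , eq′ = Π-surjective U
          in S′ , Π-reflects (subst (_⊆ Π S) (sym eq′) U⊆) , trans (cong ν eq′) eq
      }

    extended-shared : ∀ {S} → a ∉ S → extended S ≡ ψ S
    extended-shared {S} a∉ with a ∈? S
    ... | yes a∈ = ⊥-elim (a∉ a∈)
    ... | no _ = trans (ν-κ S) (cong ψ (-a-unchanged a∉))

-- Trees of simplices

module _ {d : ℕ} where

  _≟ʷ_ : (w v : Word d) → Dec (w ≡ v)
  _≟ʷ_ = List.≡-dec _≟_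

  w≢w∷ʳa : ∀ {w : Word d} {a} → w ≢ w ∷ʳ a
  w≢w∷ʳa {w} eq = ℕ.m≢1+n+m 0 (ℕ.+-cancelˡ-≡ (length w) 0 1
    (trans (ℕ.+-identityʳ _) (trans (cong length eq) (List.length-++ w))))

  ∷ʳ≢[] : ∀ (w : Word d) {a} → w ∷ʳ a ≢ []
  ∷ʳ≢[] [] ()
  ∷ʳ≢[] (_ ∷ _) ()

  -- A record instead of the bare equation, so that r and w can be inferred from a proof.
  record Simplex (r : Code d) (w : Word d) : Set where
    constructor simplex
    field child-at : kindAt r w ≡ child
  open Simplex

  filled : ∀ {r w} → Simplex r w → Filled (kindAt r w)
  filled w∈ = subst Filled (sym (child-at w∈)) child

  parent : ∀ {r w a} → Simplex r (w ∷ʳ a) → Simplex r w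
  parent {r} {w} {a} w∈ = simplex (kindAt-parent r w a (filled w∈))

  -- The two simplices share a face with the colours S.
  TreeLink : Code d → Subset (suc d) → Word d → Word d → Set
  TreeLink r S w v = ∃ λ a → v ≡ w ∷ʳ a × Simplex r v × a ∉ S

  -- A boundary cell of rank d equals the cell H that witnesses this, and H lies in only one d-cell.
  boundary⇒≡ : ∀ {T : CellComplex} {σ E F} → Rank T d σ → InBoundary d T σ →
               Rank T (suc d) E → Rank T (suc d) F → T ∋ σ ⊑ E → T ∋ σ ⊑ F → E ≡ F
  boundary⇒≡ {T} rσ (H , rH , (X , _ , unique) , σ⊑H) rE rF σ⊑E σ⊑F
    with rank-⊑ {T = T} rσ rH σ⊑H
  ... | refl = trans (sym (unique (rE , σ⊑E))) (unique (rF , σ⊑F))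

  -- The heart is `linked`: in a tree, faces coincide only by a chain of tree edges that carry them,
  -- and then with equal colours. It later yields both the connectedness of the simplices around a
  -- ridge and the completeness of `Same` before any identification.
  record TreeOfSimplices (T : CellComplex) (n : ℕ) : Set where
    field
      code     : Code d
      χ        : Word d → Subset (suc d) → Cell T
      embedded : ∀ {w} → Simplex code w → Embedding T (χ w)
      covered  : ∀ G → ∃ λ w → Simplex code w × ∃ λ S → χ w S ≡ G
      listed   : ∃ λ (e : Fin n → Word d) → ∀ {w} → Simplex code w → ∃ λ j → e j ≡ w
      size     : suc (children code) ≡ n
      unmarked : ∀ w {m} → kindAt code w ≢ mark m
      glued    : ∀ {w a} → Simplex code (w ∷ʳ a) → ∀ {S} → a ∉ S → χ w S ≡ χ (w ∷ʳ a) S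
      linked   : ∀ {w v} → Simplex code w → Simplex code v → ∀ {S U} → χ w S ≡ χ v U →
                 S ≡ U × EqClosure (TreeLink code S) w v

    simplex-unique : ∀ {w v} → Simplex code w → Simplex code v → χ w ⊤ ≡ χ v ⊤ → w ≡ v
    simplex-unique w v eq with proj₂ (linked w v eq)
    ... | ε = refl
    ... | fwd (a , _ , _ , a∉) ◅ _ = ⊥-elim (a∉ ∈⊤)
    ... | bwd (a , _ , _ , a∉) ◅ _ = ⊥-elim (a∉ ∈⊤)

    rank-⊤ : ∀ {w} → Simplex code w → Rank T (suc d) (χ w ⊤)
    rank-⊤ w = rank (embedded w) (∣⊤∣≡n _)

    χ⊑⊤ : ∀ {w} → Simplex code w → ∀ {S} → T ∋ χ w S ⊑ χ w ⊤
    χ⊑⊤ w = Embedding.mono (embedded w) ⊆⊤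

  ≢void : ∀ {r w} → Simplex r w → kindAt r w ≢ void
  ≢void v∈ eq with trans (sym (child-at v∈)) eq
  ... | ()

  root-only : ∀ w → Simplex (replicate (suc d) none) w → w ≡ []
  root-only [] w∈ = refl
  root-only (a ∷ w) w∈ = ⊥-elim (none-flat a w
    (subst (λ s → Filled (slotKind a s w)) (Vec.lookup-replicate a none) (filled w∈)))

  simplex⇒tree : ∀ {T} → IsSimplex d T → TreeOfSimplices T 1
  simplex⇒tree {T} (F , c , F-top) = record
    { code     = replicate _ none
    ; χ        = λ _ → Chart.cell c
    ; embedded = λ _ → ChartProperties.embedding T c
    ; covered  = λ G → [] , simplex refl , ChartProperties.below T c (F-top G)
    ; listed   = (λ _ → []) , λ {w} eq → zero , sym (root-only w eq)
    ; size     = cong suc (children-none (suc d))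
    ; unmarked = no-mark
    ; glued    = λ {w} {a} eq _ → ⊥-elim (∷ʳ≢[] w (root-only (w ∷ʳ a) eq))
    ; linked   = λ {w} {v} w∈ v∈ eq →
        Embedding.injective (ChartProperties.embedding T c) eq ,
        subst₂ (EqClosure _) (sym (root-only w w∈)) (sym (root-only v v∈)) ε
    }
    where
    no-mark : ∀ w {m} → kindAt (replicate (suc d) none) w ≢ mark m
    no-mark (a ∷ w) {m} eq = none-flat a w
      (subst (λ s → Filled (slotKind a s w)) (Vec.lookup-replicate a none) (subst Filled (sym eq) mark))

  record NewSimplex {T T′} (g : Glue d T T′) (ψ : Subset (suc d) → Cell T)
                    (a : Fin (suc d)) : Set where
    open Glue g
    field
      χ₁       : Subset (suc d) → Cell T′
      embedded : Embedding T′ χ₁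
      onto     : ∀ {G} → T′ ∋ G ⊑ new → ∃ λ S → χ₁ S ≡ G
      below    : ∀ S → T′ ∋ χ₁ S ⊑ new
      shared   : ∀ {S} → a ∉ S → χ₁ S ≡ old (ψ S)

  old-embedding : ∀ {T T′} (g : Glue d T T′) {ψ : Subset (suc d) → Cell T} →
                  Embedding T ψ → Embedding T′ (Glue.old g ∘ ψ)
  old-embedding {T} {T′} g {ψ} E = record
    { mono     = λ le → old-mono′ (E.mono le)
    ; reflects = λ le → E.reflects (old-cancel le)
    ; lower    = lower′
    }
    where
    open Glue g
    open IsOrderMonomorphism old-mono
      using () renaming (mono to old-mono′; cancel to old-cancel)
    module E = Embedding E
    lower′ : ∀ {G S} → T′ ∋ G ⊑ old (ψ S) → ∃ λ U → U ⊆ S × old (ψ U) ≡ G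
    lower′ le with old-closed le
    ... | H , refl with E.lower (old-cancel le)
    ...   | U , U⊆ , eq = U , U⊆ , cong old eq

  newSimplex : ∀ {T T′} (g : Glue d T T′) {ψ : Subset (suc d) → Cell T} →
               Embedding T ψ → ∀ {a} → ψ (facet a) ≡ Glue.σ g → NewSimplex g ψ a
  newSimplex {T} {T′} g {ψ} E {a} eq = record
    { χ₁       = X.extended
    ; embedded = X.extended-embedding
    ; onto     = λ G⊑new → let U , eq₁ = ChartProperties.below T′ new-rank G⊑new
                               S , eq₂ = X.extended-onto U
                           in S , trans eq₂ eq₁
    ; below    = λ S → ChartProperties.cell⊑ T′ new-rank _
    ; shared   = X.extended-shared
    }
    where
    open Glue g
    σ⊑new : T′ ∋ old σ ⊑ new
    σ⊑new = proj₂ (Equivalence.from (meet (old σ)) (⊑-refl T′))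
    shared = ChartProperties.below T′ new-rank σ⊑new
    module X = Extend (old-embedding g E) (ChartProperties.embedding T′ new-rank) a
                 {proj₁ shared} (trans (cong old eq) (sym (proj₂ shared)))

  module Attach {T T′ n} (t : TreeOfSimplices T n) (g : Glue d T T′)
                (w : Word d) (w∈ : Simplex (TreeOfSimplices.code t) w) (a : Fin (suc d))
                (aEq : TreeOfSimplices.χ t w (facet a) ≡ Glue.σ g)
                (x : NewSimplex g (TreeOfSimplices.χ t w) a) where
    open TreeOfSimplices t
    open Glue g
    open IsOrderMonomorphism old-mono using () renaming (injective to old-injective)
    module X = NewSimplex x

    private
      σ⊑ : T ∋ σ ⊑ χ w ⊤
      σ⊑ = subst (T ∋_⊑ χ w ⊤) aEq (χ⊑⊤ w∈)

      only : ∀ {v} → Simplex code v → T ∋ σ ⊑ χ v ⊤ → v ≡ w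
      only v∈ le = simplex-unique v∈ w∈
        (boundary⇒≡ {T} σ-rank σ-boundary (rank-⊤ v∈) (rank-⊤ w∈) le σ⊑)

      -- A child across a, or the parent if the address is void, would be a second simplex
      -- containing σ, which lies in the boundary.
      vacant : kindAt code (w ∷ʳ a) ≡ none
      vacant with kindAt code (w ∷ʳ a) in eq
      ... | none = refl
      ... | mark m = ⊥-elim (unmarked (w ∷ʳ a) eq)
      ... | child = ⊥-elim (w≢w∷ʳa (sym (only (simplex eq)
            (subst (T ∋_⊑ _) (trans (sym (glued (simplex eq) (∉facet a))) aEq) (χ⊑⊤ (simplex eq))))))
      ... | void with kindAt-void code w a (child-at w∈) eq
      ...   | v , w≡ = ⊥-elim (w≢w∷ʳa (trans (only v∈ le) w≡))
        where
        w∈′ : Simplex code (v ∷ʳ a)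
        w∈′ = subst (Simplex code) w≡ w∈
        v∈ = parent w∈′
        le : T ∋ σ ⊑ χ v ⊤
        le = subst (T ∋_⊑ χ v ⊤)
          (trans (glued w∈′ (∉facet a)) (trans (cong (λ u → χ u (facet a)) (sym w≡)) aEq))
          (χ⊑⊤ v∈)

      w′ : Word d
      w′ = w ∷ʳ a

      code′ : Code d
      code′ = put code w′ leaf

      new∈ : Simplex code′ w′
      new∈ = simplex (kindAt-put leaf code w′ vacant)

      ≢w′ : ∀ {v} → Simplex code v → v ≢ w′
      ≢w′ v∈ refl with trans (sym (child-at v∈)) vacant
      ... | ()

      old∈ : ∀ {v} → Simplex code v → Simplex code′ v
      old∈ {v} v∈ = simplex
        (trans (kindAt-put-≢ leaf code w′ v vacant (≢void v∈) (≢w′ v∈)) (child-at v∈))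

      split : ∀ {v} → Simplex code′ v → v ≡ w′ ⊎ Simplex code v
      split {v} v∈ with kindAt-put⁻ leaf leaf-flat code w′ v vacant (filled v∈)
      ... | inj₁ eq = inj₁ eq
      ... | inj₂ eq = inj₂ (simplex (trans (sym eq) (child-at v∈)))

      χ′ : Word d → Subset (suc d) → Cell T′
      χ′ v S with v ≟ʷ w′
      ... | yes _ = X.χ₁ S
      ... | no _  = old (χ v S)

      χ′-new : ∀ S → χ′ w′ S ≡ X.χ₁ S
      χ′-new S with w′ ≟ʷ w′
      ... | yes _ = refl
      ... | no ne = ⊥-elim (ne refl)

      χ′-old : ∀ {v} → Simplex code v → ∀ S → χ′ v S ≡ old (χ v S)
      χ′-old {v} v∈ S with v ≟ʷ w′
      ... | yes eq = ⊥-elim (≢w′ v∈ eq)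
      ... | no _ = refl

      embedded′ : ∀ {v} → Simplex code′ v → Embedding T′ (χ′ v)
      embedded′ {v} v∈ with v ≟ʷ w′
      ... | yes refl = X.embedded
      ... | no ne with split v∈
      ...   | inj₁ eq = ⊥-elim (ne eq)
      ...   | inj₂ v∈′ = old-embedding g (embedded v∈′)

      covered′ : ∀ G → ∃ λ v → Simplex code′ v × ∃ λ S → χ′ v S ≡ G
      covered′ G with cover G
      ... | inj₁ (H , refl) with covered H
      ...   | v , v∈ , S , refl = v , old∈ v∈ , S , χ′-old v∈ S
      covered′ G | inj₂ G⊑new with X.onto G⊑new
      ... | S , eq = w′ , new∈ , S , trans (χ′-new S) eq

      listed′ : ∃ λ (e : Fin (suc n) → Word d) → ∀ {v} → Simplex code′ v → ∃ λ j → e j ≡ v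
      listed′ = e , λ v∈ → find (split v∈)
        where
        e : Fin (suc n) → Word d
        e zero = w′
        e (suc j) = proj₁ listed j
        find : ∀ {v} → v ≡ w′ ⊎ Simplex code v → ∃ λ j → e j ≡ v
        find (inj₁ refl) = zero , refl
        find (inj₂ v∈) with proj₂ listed v∈
        ... | j , eq = suc j , eq

      unmarked′ : ∀ v {m} → kindAt code′ v ≢ mark m
      unmarked′ v {m} eq with kindAt-put⁻ leaf leaf-flat code w′ v vacant (subst Filled (sym eq) mark)
      ... | inj₂ eq′ = unmarked v (trans (sym eq′) eq)
      ... | inj₁ refl with trans (sym (child-at new∈)) eq
      ...   | ()

      glued′ : ∀ {v b} → Simplex code′ (v ∷ʳ b) → ∀ {S} → b ∉ S → χ′ v S ≡ χ′ (v ∷ʳ b) S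
      glued′ {v} {b} vb∈ {S} b∉ with split vb∈
      ... | inj₂ vb∈′ = trans (χ′-old (parent vb∈′) S)
                          (trans (cong old (glued vb∈′ b∉)) (sym (χ′-old vb∈′ S)))
      ... | inj₁ eq with List.∷ʳ-injective v w eq
      ...   | refl , refl = trans (χ′-old w∈ S) (sym (trans (χ′-new S) (X.shared b∉)))

      link-old : ∀ {S u v} → EqClosure (TreeLink code S) u v → EqClosure (TreeLink code′ S) u v
      link-old = Eq.map λ { (b , eq , v∈ , b∉) → b , eq , old∈ v∈ , b∉ }

      -- By `meet`, a face of the new simplex that is old lies in σ; so it avoids the new vertex, is
      -- a face of w, and reaches v through w.
      linked-new : ∀ {v} → Simplex code v → ∀ {S U} → X.χ₁ S ≡ old (χ v U) →
                   S ≡ U × EqClosure (TreeLink code′ S) w′ v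
      linked-new {v} v∈ {S} {U} eq = result (linked w∈ v∈ (old-injective old-eq))
        where
        S⊆ : S ⊆ facet a
        S⊆ = Embedding.reflects X.embedded
          (subst (T′ ∋ X.χ₁ S ⊑_)
            (sym (trans (X.shared (∉facet a)) (cong old aEq)))
            (Equivalence.to (meet _) ((_ , sym eq) , X.below S)))
        a∉ : a ∉ S
        a∉ a∈ = ∉facet a (S⊆ a∈)
        old-eq : old (χ w S) ≡ old (χ v U)
        old-eq = trans (sym (X.shared a∉)) eq
        result : S ≡ U × EqClosure (TreeLink code S) w v → S ≡ U × EqClosure (TreeLink code′ S) w′ v
        result (S≡U , link) = S≡U , bwd (a , refl , new∈ , a∉) ◅ link-old link

      linked′ : ∀ {u v} → Simplex code′ u → Simplex code′ v → ∀ {S U} → χ′ u S ≡ χ′ v U →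
                S ≡ U × EqClosure (TreeLink code′ S) u v
      linked′ u∈ v∈ {S} {U} eq with split u∈ | split v∈
      ... | inj₁ refl | inj₁ refl = Embedding.injective (embedded′ u∈) eq , ε
      ... | inj₁ refl | inj₂ v∈′ =
            linked-new v∈′ (trans (sym (χ′-new S)) (trans eq (χ′-old v∈′ U)))
      ... | inj₂ u∈′ | inj₂ v∈′ =
            let S≡U , link = linked u∈′ v∈′
                  (old-injective (trans (sym (χ′-old u∈′ S)) (trans eq (χ′-old v∈′ U))))
            in S≡U , link-old link
      ... | inj₂ u∈′ | inj₁ refl
            with linked-new u∈′ (trans (sym (χ′-new U)) (trans (sym eq) (χ′-old u∈′ S)))
      ...   | refl , link = refl , Eq.symmetric _ link

    result : TreeOfSimplices T′ (suc n)
    result = record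
      { code = code′ ; χ = χ′ ; embedded = embedded′ ; covered = covered′ ; listed = listed′
      ; size = cong suc (trans (children-put leaf code w′ vacant)
                 (trans (cong (_+ children code) (childrenˢ-leaf {d})) size))
      ; unmarked = unmarked′ ; glued = glued′ ; linked = linked′ }

  glueTree : ∀ {T T′ n} → TreeOfSimplices T n → Glue d T T′ → TreeOfSimplices T′ (suc n)
  glueTree {T} t g with TreeOfSimplices.covered t (Glue.σ g)
  ... | w , w∈ , S , eq
    with ≡facet {p = S} (rank≡∣∣ (TreeOfSimplices.embedded t w∈)
                          (subst (Rank T d) (sym eq) (Glue.σ-rank g)))
  ...   | a , refl = Attach.result t g w w∈ a eq (newSimplex g (TreeOfSimplices.embedded t w∈) eq)

  glueTrees : ∀ {N} (T : ℕ → CellComplex) → IsSimplex d (T 1) →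
         (∀ i → 1 ≤ i → i < N → Glue d (T i) (T (suc i))) →
         ∀ n → suc n ≤ N → TreeOfSimplices (T (suc n)) (suc n)
  glueTrees T s g zero n<N = simplex⇒tree s
  glueTrees T s g (suc n) n<N =
    glueTree (glueTrees T s g n (ℕ.≤-trans (ℕ.n≤1+n _) n<N)) (g (suc n) (s≤s z≤n) n<N)

-- Quotients and vertex labels

bottom : (T : CellComplex) → Cell T
bottom T = proj₁ (CellComplex.emptyCell T)

bottom⊑ : (T : CellComplex) → ∀ G → T ∋ bottom T ⊑ G
bottom⊑ T = proj₂ (CellComplex.emptyCell T)

⊥⇒bottom : ∀ {T n} {χ : Subset n → Cell T} → Embedding T χ → χ ⊥ ≡ bottom T
⊥⇒bottom {T} {χ = χ} E with Embedding.lower E (bottom⊑ T (χ ⊥))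
... | U , U⊆ , eq = trans (cong χ (⊆-antisym ⊥⊆ U⊆)) eq

bottom⇒⊥ : ∀ {T n} {χ : Subset n → Cell T} → Embedding T χ → ∀ {S} → χ S ≡ bottom T → S ≡ ⊥
bottom⇒⊥ E eq = Embedding.injective E (trans eq (sym (⊥⇒bottom E)))

-- The part of `Embedding` that passes to quotients with no further knowledge. Order reflection is
-- left out, and is recovered from labels; `nonempty` keeps vertices from collapsing to the empty
-- cell.
record Presented {d} (T : CellComplex) (code : Code d)
                 (χ : Word d → Subset (suc d) → Cell T) : Set where
  field
    mono     : ∀ {w} → Simplex code w → ∀ {S U} → S ⊆ U → T ∋ χ w S ⊑ χ w U
    lower    : ∀ {w} → Simplex code w → ∀ {G S} → T ∋ G ⊑ χ w S → ∃ λ U → U ⊆ S × χ w U ≡ G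
    nonempty : ∀ {w} → Simplex code w → ∀ {S} → χ w S ≡ bottom T → S ≡ ⊥
    covered  : ∀ G → ∃ λ w → Simplex code w × ∃ λ S → χ w S ≡ G

tree-presented : ∀ {d T n} (t : TreeOfSimplices {d} T n) →
                 Presented T (TreeOfSimplices.code t) (TreeOfSimplices.χ t)
tree-presented {T = T} t = record
  { mono     = λ w∈ → Embedding.mono (embedded w∈)
  ; lower    = λ w∈ → Embedding.lower (embedded w∈)
  ; nonempty = λ w∈ → bottom⇒⊥ (embedded w∈)
  ; covered  = covered
  }
  where open TreeOfSimplices t

module Quotient {d T T′} (i : Identify d T T′) where
  open Identify i

  quot-mono : ∀ {G H} → T ∋ G ⊑ H → T′ ∋ quot G ⊑ quot H
  quot-mono le = Equivalence.from (order _ _) (_ , _ , refl , refl , le)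

  quot-≡ : ∀ {G H} → Match G H → quot G ≡ quot H
  quot-≡ m = Equivalence.from (kernel _ _) (fwd m ◅ ε)

  lower-match : ∀ {G H H′} → SymClosure Match H H′ → T ∋ G ⊑ H →
                ∃ λ G′ → T ∋ G′ ⊑ H′ × quot G′ ≡ quot G
  lower-match (fwd (S , refl , refl)) le with Embedding.lower (ChartProperties.embedding T σ-chart) le
  ... | U , U⊆S , refl = τ.cell U , Embedding.mono (ChartProperties.embedding T τ-chart) U⊆S ,
                         sym (quot-≡ (U , refl , refl))
  lower-match (bwd (S , refl , refl)) le with Embedding.lower (ChartProperties.embedding T τ-chart) le
  ... | U , U⊆S , refl = σ.cell U , Embedding.mono (ChartProperties.embedding T σ-chart) U⊆S ,
                         quot-≡ (U , refl , refl)

  lower-closure : ∀ {G H H′} → EqClosure Match H H′ → T ∋ G ⊑ H →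
                  ∃ λ G′ → T ∋ G′ ⊑ H′ × quot G′ ≡ quot G
  lower-closure ε le = _ , le , refl
  lower-closure (m ◅ ms) le with lower-match m le
  ... | _ , le′ , eq with lower-closure ms le′
  ...   | _ , le″ , eq′ = _ , le″ , trans eq′ eq

  -- The quotient order only relates some representatives. The isomorphism of [0,σ] with [0,τ] moves
  -- a face along with its cell, until the upper representative has become H.
  quot-lower : ∀ {y H} → T′ ∋ y ⊑ quot H → ∃ λ G → T ∋ G ⊑ H × quot G ≡ y
  quot-lower le with Equivalence.to (order _ _) le
  ... | G , H′ , refl , eq , G⊑H′ = lower-closure (Equivalence.to (kernel _ _) eq) G⊑H′

  match-bottom : ∀ {G} → SymClosure Match G (bottom T) → G ≡ bottom T
  match-bottom (fwd (S , refl , eq)) =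
    trans (cong σ.cell (bottom⇒⊥ (ChartProperties.embedding T τ-chart) eq))
          (⊥⇒bottom (ChartProperties.embedding T σ-chart))
  match-bottom (bwd (S , eq , refl)) =
    trans (cong τ.cell (bottom⇒⊥ (ChartProperties.embedding T σ-chart) eq))
          (⊥⇒bottom (ChartProperties.embedding T τ-chart))

  closure-bottom : ∀ {G H} → EqClosure Match G H → H ≡ bottom T → G ≡ bottom T
  closure-bottom ε eq = eq
  closure-bottom (m ◅ ms) eq with closure-bottom ms eq
  ... | refl = match-bottom m

  quot-bottom : ∀ {G} → quot G ≡ bottom T′ → G ≡ bottom T
  quot-bottom {G} eq = closure-bottom (Equivalence.to (kernel _ _) (trans eq (sym below))) refl
    where
    below : quot (bottom T) ≡ bottom T′
    below with surjective (bottom T′)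
    ... | B , eqB = ⊑-antisym T′ (subst (T′ ∋ quot (bottom T) ⊑_) eqB (quot-mono (bottom⊑ T B)))
                      (bottom⊑ T′ _)

  quotient-presented : ∀ {code : Code d} {χ} → Presented T code χ →
                       Presented T′ code (λ w S → quot (χ w S))
  quotient-presented {code} {χ} p = record
    { mono     = λ w∈ le → quot-mono (mono w∈ le)
    ; lower    = λ w∈ le → lower′ w∈ (quot-lower le)
    ; nonempty = λ w∈ eq → nonempty w∈ (quot-bottom eq)
    ; covered  = covered′
    }
    where
    open Presented p
    lower′ : ∀ {w} → Simplex code w → ∀ {y S} → (∃ λ G → T ∋ G ⊑ χ w S × quot G ≡ y) →
             ∃ λ U → U ⊆ S × quot (χ w U) ≡ y
    lower′ w∈ (G , le , refl) with lower w∈ le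
    ... | U , U⊆ , refl = U , U⊆ , refl
    covered′ : ∀ y → ∃ λ w → Simplex code w × ∃ λ S → quot (χ w S) ≡ y
    covered′ y with surjective y
    ... | G , refl with covered G
    ...   | w , w∈ , S , refl = w , w∈ , S , refl

-- The labels ℓ are vertices of the final complex and are the same at every stage; `φ` gives the
-- vertex set of the image of a cell there. So facts about the final complex become available at
-- earlier stages by composing `φ` with the quotient map.
record Labelled {d V} (ℓ : Word d → Fin (suc d) → Fin V) (code : Code d)
                (T : CellComplex) (χ : Word d → Subset (suc d) → Cell T) : Set where
  field
    φ           : Cell T → Subset V
    label⁺      : ∀ {w} → Simplex code w → ∀ {S x} → x ∈ S → ℓ w x ∈ φ (χ w S)
    label⁻      : ∀ {w} → Simplex code w → ∀ {S u} → u ∈ φ (χ w S) → ∃ λ x → x ∈ S × ℓ w x ≡ u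
    ℓ-injective : ∀ {w} → Simplex code w → ∀ {x y} → ℓ w x ≡ ℓ w y → x ≡ y
    distinct    : ∀ {w v} → Simplex code w → Simplex code v → φ (χ w ⊤) ≡ φ (χ v ⊤) → w ≡ v
    thin        : ∀ {w v u} → Simplex code w → Simplex code v → Simplex code u → ∀ {a b c} →
                  χ w (facet a) ≡ χ v (facet b) → χ w (facet a) ≡ χ u (facet c) →
                  w ≡ v ⊎ w ≡ u ⊎ v ≡ u

pullback : ∀ {d V} {ℓ : Word d → Fin (suc d) → Fin V} {code T T′ χ} (q : Cell T → Cell T′) →
           Labelled ℓ code T′ (λ w S → q (χ w S)) → Labelled ℓ code T χ
pullback q l = record
  { φ = φ ∘ q ; label⁺ = label⁺ ; label⁻ = label⁻ ; ℓ-injective = ℓ-injective ; distinct = distinct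
  ; thin = λ w∈ v∈ u∈ eq eq′ → thin w∈ v∈ u∈ (cong q eq) (cong q eq′) }
  where open Labelled l

-- If `χ w S` lies below `χ w U`, the labels of S are among those of U, and labels separate the
-- colours of w.
label-embedding : ∀ {d V T code χ} {ℓ : Word d → Fin (suc d) → Fin V} {φ : Cell T → Subset V} →
  Presented T code χ → ∀ {w} → Simplex code w →
  (∀ {S x} → x ∈ S → ℓ w x ∈ φ (χ w S)) →
  (∀ {S u} → u ∈ φ (χ w S) → ∃ λ x → x ∈ S × ℓ w x ≡ u) →
  (∀ {x y} → ℓ w x ≡ ℓ w y → x ≡ y) → Embedding T (χ w)
label-embedding {T = T} {χ = χ} {ℓ} {φ} p {w} w∈ label⁺ label⁻ ℓ-inj = record
  { mono = mono w∈ ; reflects = λ {S} {U} le → reflects′ (lower w∈ le) ; lower = lower w∈ }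
  where
  open Presented p
  reflects′ : ∀ {S U} → (∃ λ U′ → U′ ⊆ U × χ w U′ ≡ χ w S) → S ⊆ U
  reflects′ (U′ , U′⊆U , eq) {x} x∈ with label⁻ (subst (λ G → ℓ w x ∈ φ G) (sym eq) (label⁺ x∈))
  ... | y , y∈ , ℓ≡ = U′⊆U (subst (_∈ U′) (ℓ-inj ℓ≡) y∈)

data Identifications (d : ℕ) : CellComplex → CellComplex → Set₁ where
  done : ∀ {T} → Identifications d T T
  _▸_  : ∀ {T T′ T″} → Identify d T T′ → Identifications d T′ T″ → Identifications d T T″

identifications : ∀ {d N k} (T : ℕ → CellComplex) →
                  (∀ i → N ≤ i → i < k → Identify d (T i) (T (suc i))) →
                  ∀ j i → N ≤ i → i + j ≡ k → Identifications d (T i) (T k)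
identifications T f zero i N≤i refl rewrite ℕ.+-identityʳ i = done
identifications T f (suc j) i N≤i refl =
  f i N≤i (ℕ.m<m+n i (s≤s z≤n)) ▸
  identifications T f j (suc i) (ℕ.m≤n⇒m≤1+n N≤i) (sym (ℕ.+-suc i j))

quotient : ∀ {d T T′} → Identifications d T T′ → Cell T → Cell T′
quotient done     G = G
quotient (i ▸ is) G = quotient is (Identify.quot i G)

presented : ∀ {d T T′ code χ} (is : Identifications d T T′) → Presented T code χ →
            Presented T′ code (λ w S → quotient is (χ w S))
presented done p     = p
presented (i ▸ is) p = presented is (Quotient.quotient-presented i p)

-- Labels read off the final complex

module FinalLabels {d N} (C : SimplicialComplex) (facets : HasFacets d N C)
                   {T : CellComplex} (pm : IsPseudomanifold d T) (end : IsFacePosetOf C T)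
                   {code : Code d} {χ} (p : Presented T code χ)
                   (listed : ∃ λ (e : Fin N → Word d) → ∀ {w} → Simplex code w → ∃ λ j → e j ≡ w)
                   where
  open Presented p
  open SimplicialComplex C

  f : Cell T → Subset V
  f = proj₁ end

  open IsOrderMonomorphism (proj₁ (proj₂ end)) public
    using () renaming (mono to f-mono; cancel to f-cancel; injective to f-injective)

  face : ∀ {S} → Face S → ∃ λ G → f G ≡ S
  face = Equivalence.to (proj₂ (proj₂ end) _)

  χ-⊥ : ∀ {w} → Simplex code w → χ w ⊥ ≡ bottom T
  χ-⊥ {w} w∈ with lower w∈ (bottom⊑ T (χ w ⊥))
  ... | U , U⊆ , eq = trans (cong (χ w) (⊆-antisym ⊥⊆ U⊆)) eq

  f-bottom : f (bottom T) ≡ ⊥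
  f-bottom with face empty
  ... | B , eq = ⊆-antisym (subst (f (bottom T) ⊆_) eq (f-mono (bottom⊑ T B))) ⊥⊆

  vertex-nonempty : ∀ {w} → Simplex code w → ∀ x → Nonempty (f (χ w ⁅ x ⁆))
  vertex-nonempty {w} w∈ x with nonempty? (f (χ w ⁅ x ⁆))
  ... | yes ne = ne
  ... | no empty = ⊥-elim (∉⊥ (subst (x ∈_) (nonempty w∈ (f-injective
                     (trans (Empty-unique empty) (sym f-bottom)))) (x∈⁅x⁆ x)))

  -- The cell of the vertex u is some `χ w U` with U nonempty. As `χ w` is not yet known to be
  -- injective, U might have several members; each of them has a nonempty image inside ⁅ u ⁆.
  vertex : ∀ {w} → Simplex code w → ∀ {S u} → u ∈ f (χ w S) → ∃ λ x → x ∈ S × f (χ w ⁅ x ⁆) ≡ ⁅ u ⁆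
  vertex {w} w∈ {S} {u} u∈ with face (vertices u)
  ... | G , fG with lower w∈ (f-cancel (subst (_⊆ f (χ w S)) (sym fG) (⁅⁆⊆ u∈)))
  ...   | U , U⊆S , refl with nonempty? U
  ...     | no ∄ = ⊥-elim (∉⊥ (subst (u ∈_)
              (trans (sym fG) (trans (cong f (trans (cong (χ w) (Empty-unique ∄)) (χ-⊥ w∈))) f-bottom))
              (x∈⁅x⁆ u)))
  ...     | yes (x , x∈U) = x , U⊆S x∈U , ⊆-antisym sub (⁅⁆⊆ u∈f)
    where
    sub : f (χ w ⁅ x ⁆) ⊆ ⁅ u ⁆
    sub = subst (f (χ w ⁅ x ⁆) ⊆_) fG (f-mono (mono w∈ (⁅⁆⊆ x∈U)))
    u∈f : u ∈ f (χ w ⁅ x ⁆)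
    u∈f with vertex-nonempty w∈ x
    ... | u′ , u′∈ = subst (_∈ f (χ w ⁅ x ⁆)) (x∈⁅y⁆⇒x≡y u (sub u′∈)) u′∈

  -- Only the values at simplices matter.
  ℓ : Word d → Fin (suc d) → Fin V
  ℓ w x with nonempty? (f (χ w ⁅ x ⁆))
  ... | yes (u , _) = u
  ... | no _ = proj₁ (vertex-nonempty (simplex {w = []} refl) zero)

  ℓ-spec : ∀ {w} → Simplex code w → ∀ x → f (χ w ⁅ x ⁆) ≡ ⁅ ℓ w x ⁆
  ℓ-spec {w} w∈ x with nonempty? (f (χ w ⁅ x ⁆))
  ... | no ∄ = ⊥-elim (∄ (vertex-nonempty w∈ x))
  ... | yes (u , u∈) with vertex w∈ u∈
  ...   | y , y∈ , eq rewrite x∈⁅y⁆⇒x≡y x y∈ = eq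

  label⁺ : ∀ {w} → Simplex code w → ∀ {S x} → x ∈ S → ℓ w x ∈ f (χ w S)
  label⁺ {w} w∈ {S} {x} x∈ =
    f-mono (mono w∈ (⁅⁆⊆ x∈)) (subst (ℓ w x ∈_) (sym (ℓ-spec w∈ x)) (x∈⁅x⁆ _))

  label⁻ : ∀ {w} → Simplex code w → ∀ {S u} → u ∈ f (χ w S) → ∃ λ x → x ∈ S × ℓ w x ≡ u
  label⁻ {w} w∈ u∈ with vertex w∈ u∈
  ... | x , x∈ , eq = x , x∈ , x∈⁅y⁆⇒x≡y _
    (subst (ℓ w x ∈_) (trans (sym (ℓ-spec w∈ x)) eq) (x∈⁅x⁆ _))

  private
    g : Fin N → Subset V
    g = proj₁ facets

    g-facet : ∀ i → IsFacet d C (g i)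
    g-facet i = Equivalence.from (proj₂ (proj₂ facets) (g i)) (i , refl)

    -- A simplex has at most d + 1 labels, one for each colour, so one that contains a facet has no
    -- vertex outside it.
    facet-simplex : ∀ i → ∃ λ w → Simplex code w × f (χ w ⊤) ≡ g i
    facet-simplex i with face (proj₁ (g-facet i))
    ... | G , fG with covered G
    ...   | w , w∈ , S , refl = w , w∈ , sym (⊆∧≤⇒≡ g⊆ (ℕ.≤-trans small
              (ℕ.≤-reflexive (sym (proj₂ (g-facet i))))))
      where
      g⊆ : g i ⊆ f (χ w ⊤)
      g⊆ = subst (_⊆ f (χ w ⊤)) fG (f-mono (mono w∈ ⊆⊤))
      small : ∣ f (χ w ⊤) ∣ ≤ suc d
      small = ℕ.≤-trans (injection⇒∣∣≤ (λ u x → ℓ w x ≡ u) (f (χ w ⊤)) ⊤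
                          (label⁻ w∈) (λ eq eq′ → trans (sym eq) eq′))
                (ℕ.≤-reflexive (∣⊤∣≡n _))

    index : Fin N → Fin N
    index i = proj₁ (proj₂ listed (proj₁ (proj₂ (facet-simplex i))))

    index-spec : ∀ i → proj₁ listed (index i) ≡ proj₁ (facet-simplex i)
    index-spec i = proj₂ (proj₂ listed (proj₁ (proj₂ (facet-simplex i))))

    index-injective : ∀ {i j} → index i ≡ index j → i ≡ j
    index-injective {i} {j} eq = proj₁ (proj₂ facets)
      (trans (sym (proj₂ (proj₂ (facet-simplex i))))
        (trans (cong (λ w → f (χ w ⊤))
          (trans (sym (index-spec i)) (trans (cong (proj₁ listed) eq) (index-spec j))))
          (proj₂ (proj₂ (facet-simplex j)))))

    -- There are as many facets as simplices, so every simplex is a facet.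
    simplex-facet : ∀ {w} → Simplex code w → ∃ λ i → w ≡ proj₁ (facet-simplex i)
    simplex-facet {w} w∈ with proj₂ listed w∈
    ... | j , ej with injective⇒surjective index index-injective j
    ...   | i , refl = i , trans (sym ej) (index-spec i)

    size : ∀ {w} → Simplex code w → ∣ f (χ w ⊤) ∣ ≡ suc d
    size w∈ with simplex-facet w∈
    ... | i , refl = trans (cong ∣_∣ (proj₂ (proj₂ (facet-simplex i)))) (proj₂ (g-facet i))

    -- If x shared its label with y, the d colours other than x would account for all d + 1
    -- vertices.
    ℓ-injective : ∀ {w} → Simplex code w → ∀ {x y} → ℓ w x ≡ ℓ w y → x ≡ y
    ℓ-injective {w} w∈ {x} {y} eq with x ≟ y
    ... | yes x≡y = x≡y
    ... | no x≢y = ⊥-elim (ℕ.1+n≰n (subst₂ _≤_ (size w∈) (∣facet∣ x)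
            (injection⇒∣∣≤ (λ u z → ℓ w z ≡ u) (f (χ w ⊤)) (facet x) avoid
              (λ e e′ → trans (sym e) e′))))
      where
      avoid : ∀ {u} → u ∈ f (χ w ⊤) → ∃ λ z → z ∈ facet x × ℓ w z ≡ u
      avoid u∈ with label⁻ w∈ u∈
      ... | z , _ , ℓz with z ≟ x
      ...   | no z≢x = z , ∈facet⁺ z≢x , ℓz
      ...   | yes refl = y , ∈facet⁺ (x≢y ∘ sym) , trans (sym eq) ℓz

    distinct : ∀ {w v} → Simplex code w → Simplex code v → f (χ w ⊤) ≡ f (χ v ⊤) → w ≡ v
    distinct w∈ v∈ eq with simplex-facet w∈ | simplex-facet v∈
    ... | i , refl | j , refl = cong (proj₁ ∘ facet-simplex) (proj₁ (proj₂ facets)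
          (trans (sym (proj₂ (proj₂ (facet-simplex i)))) (trans eq (proj₂ (proj₂ (facet-simplex j))))))

    embedding : ∀ {w} → Simplex code w → Embedding T (χ w)
    embedding w∈ = label-embedding {ℓ = ℓ} {φ = f} p w∈ (label⁺ w∈) (label⁻ w∈) (ℓ-injective w∈)

    thin : ∀ {w v u} → Simplex code w → Simplex code v → Simplex code u → ∀ {a b c} →
           χ w (facet a) ≡ χ v (facet b) → χ w (facet a) ≡ χ u (facet c) →
           w ≡ v ⊎ w ≡ u ⊎ v ≡ u
    thin {w} {v} {u} w∈ v∈ u∈ {a} {b} {c} eq eq′
      with IsPseudomanifold.thin pm (rank (embedding w∈) (∣facet∣ a))
             (top w∈) (top v∈) (top u∈) (mono w∈ ⊆⊤)
             (subst (T ∋_⊑ χ v ⊤) (sym eq) (mono v∈ ⊆⊤)) (subst (T ∋_⊑ χ u ⊤) (sym eq′) (mono u∈ ⊆⊤))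
      where
      top : ∀ {w} → Simplex code w → Rank T (suc d) (χ w ⊤)
      top w∈ = rank (embedding w∈) (∣⊤∣≡n _)
    ... | inj₁ e = inj₁ (distinct w∈ v∈ (cong f e))
    ... | inj₂ (inj₁ e) = inj₂ (inj₁ (distinct w∈ u∈ (cong f e)))
    ... | inj₂ (inj₂ e) = inj₂ (inj₂ (distinct v∈ u∈ (cong f e)))

  labelled : Labelled ℓ code T χ
  labelled = record { φ = f ; label⁺ = label⁺ ; label⁻ = label⁻ ; ℓ-injective = ℓ-injective
                    ; distinct = distinct ; thin = thin }

-- Marks and the invariant of the identification steps

module _ {d : ℕ} where

  open Simplex

  -- The facet of w opposite to a is glued along its ridge opposite to b.
  record Marked (r : Code d) (w : Word d) (a b : Fin (suc d)) : Set where
    constructor marked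
    field
      {index} : Fin d
      mark-at : kindAt r (w ∷ʳ a) ≡ mark index
      port    : b ≡ punchIn a index
  open Marked

  marked-filled : ∀ {r w a b} → Marked r w a b → Filled (kindAt r (w ∷ʳ a))
  marked-filled m = subst Filled (sym (mark-at m)) mark

  marked-simplex : ∀ {r w a b} → Marked r w a b → Simplex r w
  marked-simplex {r} {w} {a} m = simplex (kindAt-parent r w a (marked-filled m))

  marked-≢ : ∀ {r w a b} → Marked r w a b → b ≢ a
  marked-≢ {a = a} (marked _ refl) = Fin.punchInᵢ≢i a _

  -- The vertex identifications that a code prescribes: when two marked
  -- ridges have the same vertices, their facets are glued along them.
  data Same (r : Code d) : (w : Word d) (x : Fin (suc d)) (v : Word d) (y : Fin (suc d)) → Set where
    same-refl  : ∀ {w x} → Same r w x w x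
    same-sym   : ∀ {w x v y} → Same r w x v y → Same r v y w x
    same-trans : ∀ {w x v y u z} → Same r w x v y → Same r v y u z → Same r w x u z
    same-tree  : ∀ {w a x} → Simplex r (w ∷ʳ a) → x ≢ a → Same r w x (w ∷ʳ a) x
    same-zip   : ∀ {w a b v c e} → Marked r w a b → Marked r v c e → ¬ (w ≡ v × a ≡ c) →
                 (∀ {x} → x ∈ ridge a b → ∃ λ y → y ∈ ridge c e × Same r w x v y) →
                 (∀ {y} → y ∈ ridge c e → ∃ λ x → x ∈ ridge a b × Same r w x v y) →
                 Same r w b v e

  same-map : ∀ {r r′} → (∀ {w} → Simplex r w → Simplex r′ w) →
             (∀ {w a b} → Marked r w a b → Marked r′ w a b) →
             ∀ {w x v y} → Same r w x v y → Same r′ w x v y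
  same-map f g same-refl = same-refl
  same-map f g (same-sym s) = same-sym (same-map f g s)
  same-map f g (same-trans s t) = same-trans (same-map f g s) (same-map f g t)
  same-map f g (same-tree w∈ x≢a) = same-tree (f w∈) x≢a
  same-map f g (same-zip m m′ ne to from) = same-zip (g m) (g m′) ne
    (λ x∈ → let y , y∈ , s = to x∈ in y , y∈ , same-map f g s)
    (λ y∈ → let x , x∈ , s = from y∈ in x , x∈ , same-map f g s)

  -- The field `vacant` lets the second mark of an identification be placed after the first.
  record Marking (r : Code d) (w : Word d) (a b : Fin (suc d)) : Set where
    field
      code      : Code d
      simplex⁺  : ∀ {v} → Simplex r v → Simplex code v
      simplex⁻  : ∀ {v} → Simplex code v → Simplex r v
      size      : children code ≡ children r
      marked-new : Marked code w a b
      marked-old : ∀ {v c e} → Marked r v c e → Marked code v c e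
      marked-cases : ∀ {v c e} → Marked code v c e → (v ≡ w × c ≡ a × e ≡ b) ⊎ Marked r v c e
      vacant    : ∀ {v c} → kindAt r (v ∷ʳ c) ≡ none → ¬ (w ≡ v × a ≡ c) → kindAt code (v ∷ʳ c) ≡ none

  marking : ∀ (r : Code d) (w : Word d) {a b : Fin (suc d)} →
            kindAt r (w ∷ʳ a) ≡ none → a ≢ b → Marking r w a b
  marking r w {a} {b} free a≢b = record
    { code = code ; simplex⁺ = simplex⁺ ; simplex⁻ = simplex⁻ ; size = children-put s r (w ∷ʳ a) free
    ; marked-new = marked mark-new (sym (Fin.punchIn-punchOut a≢b)) ; marked-old = marked-old
    ; marked-cases = marked-cases
    ; vacant = λ {v} {c} eq ne → trans (kindAt-put-≢ s r (w ∷ʳ a) (v ∷ʳ c) free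
        (λ eq′ → void≢none (trans (sym eq′) eq))
        (λ e → ne (let e₁ , e₂ = List.∷ʳ-injective v w e in sym e₁ , sym e₂))) eq
    }
    where
    s : Slot d
    s = mark (punchOut a≢b)
    code : Code d
    code = put r (w ∷ʳ a) s
    void≢none : void ≢ none {d}
    void≢none ()
    mark-new : kindAt code (w ∷ʳ a) ≡ mark (punchOut a≢b)
    mark-new = kindAt-put s r (w ∷ʳ a) free
    keep : ∀ v → Filled (kindAt r v) → kindAt code v ≡ kindAt r v
    keep v f = kindAt-put-≢ s r (w ∷ʳ a) v free
      (λ eq → case-void (subst Filled eq f))
      (λ where refl → case-none (subst Filled free f))
      where
      case-void : ¬ Filled (void {d})
      case-void ()
      case-none : ¬ Filled (none {d})
      case-none ()
    simplex⁺ : ∀ {v} → Simplex r v → Simplex code v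
    simplex⁺ {v} v∈ = simplex (trans (keep v (filled v∈)) (child-at v∈))
    simplex⁻ : ∀ {v} → Simplex code v → Simplex r v
    simplex⁻ {v} v∈ with kindAt-put⁻ s (mark-flat (punchOut a≢b)) r (w ∷ʳ a) v free (filled v∈)
    ... | inj₂ eq = simplex (trans (sym eq) (child-at v∈))
    ... | inj₁ refl with trans (sym mark-new) (child-at v∈)
    ...   | ()
    marked-old : ∀ {v c e} → Marked r v c e → Marked code v c e
    marked-old {v} {c} m = marked (trans (keep (v ∷ʳ c) (marked-filled m)) (mark-at m)) (port m)
    marked-cases : ∀ {v c e} → Marked code v c e → (v ≡ w × c ≡ a × e ≡ b) ⊎ Marked r v c e
    marked-cases {v} {c} m
      with kindAt-put⁻ s (mark-flat (punchOut a≢b)) r (w ∷ʳ a) (v ∷ʳ c) free (marked-filled m)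
    ... | inj₂ eq = inj₂ (marked (trans (sym eq) (mark-at m)) (port m))
    ... | inj₁ eq with List.∷ʳ-injective v w eq
    ...   | refl , refl with trans (sym mark-new) (mark-at m)
    ...     | refl = inj₁ (refl , refl , trans (port m) (Fin.punchIn-punchOut a≢b))

facet-injective : ∀ {n} {a b : Fin n} → facet a ≡ facet b → a ≡ b
facet-injective {a = a} {b} eq with a ≟ b
... | yes a≡b = a≡b
... | no a≢b = ⊥-elim (∉facet a (subst (a ∈_) (sym eq) (∈facet⁺ a≢b)))

ridge-injective : ∀ {n} {a b c : Fin n} → a ≢ c → ridge a b ≡ ridge a c → b ≡ c
ridge-injective {a = a} {b} {c} a≢c eq with c ≟ b
... | yes c≡b = sym c≡b
... | no c≢b = ⊥-elim (proj₂ (∈ridge⁻ (subst (c ∈_) eq (∈ridge⁺ (a≢c ∘ sym) c≢b))) refl)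

-- The half ridge (w , a , b) is the ridge of w opposite to a and b, seen
-- from the facet opposite to a; it is glued to another one if the facets
-- are the same cell, and so are the ridges.
Half : ℕ → Set
Half d = Word d × Fin (suc d) × Fin (suc d)

swapHalf : ∀ {d} → Half d → Half d
swapHalf (w , a , b) = w , b , a

record Glueing {d} {T : CellComplex} (r : Code d) (χ : Word d → Subset (suc d) → Cell T)
               (h h′ : Half d) : Set where
  constructor glueing
  w = proj₁ h ; a = proj₁ (proj₂ h) ; b = proj₂ (proj₂ h)
  v = proj₁ h′ ; c = proj₁ (proj₂ h′) ; e = proj₂ (proj₂ h′)
  field
    w∈     : Simplex r w
    v∈     : Simplex r v
    a≢b    : a ≢ b
    c≢e    : c ≢ e
    other  : ¬ (w ≡ v × a ≡ c)
    facet≡ : χ w (facet a) ≡ χ v (facet c)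
    ridge≡ : χ w (ridge a b) ≡ χ v (ridge c e)

Path : ∀ {d} {T : CellComplex} → Code d → (Word d → Subset (suc d) → Cell T) → Half d → Half d → Set
Path {T = T} r χ = Star (HalfStep swapHalf (Glueing {T = T} r χ))

GluedFacet : ∀ {d} {T : CellComplex} → Code d → (Word d → Subset (suc d) → Cell T) →
             Word d → Fin (suc d) → Set
GluedFacet r χ w a = ∃ λ v → ∃ λ c → Simplex r v × ¬ (w ≡ v × a ≡ c) × χ w (facet a) ≡ χ v (facet c)

-- Decoding finds everything by `complete` and nothing else by `partner`. What keeps `partner` true
-- later is `closed`: around a marked ridge no facet is free, so no later step touches it. And
-- `closed` is proved for a new mark by the walk around its ridge, which sees all facets there by
-- `connected`.
record Invariant {d} (r : Code d) (T : CellComplex) (χ : Word d → Subset (suc d) → Cell T) : Set where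
  field
    code     : Code d
    simplex⁺ : ∀ {w} → Simplex r w → Simplex code w
    simplex⁻ : ∀ {w} → Simplex code w → Simplex r w
    size     : children code ≡ children r
    tree     : ∀ {w a} → Simplex r (w ∷ʳ a) → ∀ {S} → a ∉ S → χ w S ≡ χ (w ∷ʳ a) S
    complete : ∀ {w v} → Simplex r w → Simplex r v → ∀ {x y} →
               χ w ⁅ x ⁆ ≡ χ v ⁅ y ⁆ → Same code w x v y
    connected : ∀ {w v} → Simplex r w → Simplex r v → ∀ {a b c e} → a ≢ b → c ≢ e →
                χ w (ridge a b) ≡ χ v (ridge c e) → Path {T = T} r χ (w , a , b) (v , c , e)
    partner  : ∀ {w a b v c e} → Marked code w a b → Marked code v c e →
               χ w (ridge a b) ≡ χ v (ridge c e) →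
               (w ≡ v × a ≡ c) ⊎ χ w ⁅ b ⁆ ≡ χ v ⁅ e ⁆
    closed   : ∀ {w a b v c e} → Marked code w a b → Simplex r v → c ≢ e →
               χ w (ridge a b) ≡ χ v (ridge c e) → GluedFacet {T = T} r χ v c

module TreeInvariant {d T n} (t : TreeOfSimplices {d} T n) where
  open TreeOfSimplices t

  -- A tree edge that carries the ridge S crosses a facet whose colour f is missing from S, so f is
  -- one of the two colours of the half ridge; a swap brings it to the front when necessary.
  path : ∀ {S w v} → EqClosure (TreeLink code S) w v → Simplex code w → ∀ {a b c e} → a ≢ b → c ≢ e →
         ridge a b ≡ S → ridge c e ≡ S → Path {T = T} code χ (w , a , b) (v , c , e)
  path ε w∈ {a} {b} {c} {e} a≢b c≢e eq eq′ with a ≟ c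
  ... | yes refl with ridge-injective c≢e (trans eq (sym eq′))
  ...   | refl = ε
  path ε w∈ {a} {b} {c} {e} a≢b c≢e eq eq′ | no a≢c with b ≟ c
  ... | yes refl with ridge-injective c≢e (trans (ridge-comm b a) (trans eq (sym eq′)))
  ...   | refl = inj₁ refl ◅ ε
  path ε w∈ {a} {b} {c} {e} a≢b c≢e eq eq′ | no a≢c | no b≢c =
    ⊥-elim (proj₁ (∈ridge⁻ (subst (c ∈_) (trans eq (sym eq′)) (∈ridge⁺ (a≢c ∘ sym) (b≢c ∘ sym)))) refl)
  path {S} {w} (_◅_ {j = u} link links) w∈ {a} {b} a≢b c≢e refl eq′ = cross link
    where
    along : ∀ {f g} → f ≢ g → ridge f g ≡ S → Simplex code u → ¬ (w ≡ u) →
            (∀ {S′} → f ∉ S′ → χ w S′ ≡ χ u S′) → Path code χ (w , f , g) _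
    along {f} {g} f≢g eq u∈ w≢u same =
      inj₂ (glueing w∈ u∈ f≢g f≢g (w≢u ∘ proj₁) (same (∉facet f))
             (same λ f∈ → proj₁ (∈ridge⁻ f∈) refl)) ◅
      path links u∈ f≢g c≢e eq eq′
    choose : Simplex code u → ¬ (w ≡ u) → ∀ f → f ∉ ridge a b →
             (∀ {S′} → f ∉ S′ → χ w S′ ≡ χ u S′) → Path code χ (w , a , b) _
    choose u∈ w≢u f f∉ same with f ≟ a
    ... | yes refl = along a≢b refl u∈ w≢u same
    ... | no f≢a with f ≟ b
    ...   | yes refl = inj₁ refl ◅ along (a≢b ∘ sym) (ridge-comm f a) u∈ w≢u same
    ...   | no f≢b = ⊥-elim (f∉ (∈ridge⁺ f≢a f≢b))
    cross : _ → Path code χ (w , a , b) _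
    cross (fwd (f , refl , u∈ , f∉)) = choose u∈ w≢w∷ʳa f f∉ (glued u∈)
    cross (bwd (f , refl , w∈′ , f∉)) =
      choose (parent w∈′) (w≢w∷ʳa ∘ sym) f f∉ (sym ∘ glued w∈′)

  same : ∀ {w v x} → EqClosure (TreeLink code ⁅ x ⁆) w v → Same code w x v x
  same ε = same-refl
  same (fwd (a , refl , v∈ , a∉) ◅ links) =
    same-trans (same-tree v∈ λ where refl → a∉ (x∈⁅x⁆ a)) (same links)
  same (bwd (a , refl , v∈ , a∉) ◅ links) =
    same-trans (same-sym (same-tree v∈ λ where refl → a∉ (x∈⁅x⁆ a))) (same links)

  ⁅⁆-injective : ∀ {n} {x y : Fin n} → ⁅ x ⁆ ≡ ⁅ y ⁆ → x ≡ y
  ⁅⁆-injective {x = x} {y} eq = x∈⁅y⁆⇒x≡y y (subst (x ∈_) eq (x∈⁅x⁆ x))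

  complete′ : ∀ {w v} → Simplex code w → Simplex code v → ∀ {x y} →
              χ w ⁅ x ⁆ ≡ χ v ⁅ y ⁆ → Same code w x v y
  complete′ w∈ v∈ eq with linked w∈ v∈ eq
  ... | ≡⁅⁆ , links with ⁅⁆-injective ≡⁅⁆
  ...   | refl = same links

  invariant : Invariant code T χ
  invariant = record
    { code = code ; simplex⁺ = id ; simplex⁻ = id ; size = refl
    ; tree = glued
    ; complete = complete′
    ; connected = λ w∈ v∈ a≢b c≢e eq →
        let S≡U , links = linked w∈ v∈ eq in path links w∈ a≢b c≢e refl (sym S≡U)
    ; partner = λ {w} {a} m → ⊥-elim (unmarked (w ∷ʳ a) (mark-at m))
    ; closed = λ {w} {a} m → ⊥-elim (unmarked (w ∷ʳ a) (mark-at m))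
    }
    where open Marked

-- One identification step

module LabelFacts {d V T} {r : Code d} {χ : Word d → Subset (suc d) → Cell T}
                  {ℓ : Word d → Fin (suc d) → Fin V}
                  (p : Presented T r χ) (l : Labelled ℓ r T χ) where
  open Presented p
  open Labelled l

  embedded : ∀ {w} → Simplex r w → Embedding T (χ w)
  embedded w∈ = label-embedding {ℓ = ℓ} {φ = φ} p w∈ (label⁺ w∈) (label⁻ w∈) (ℓ-injective w∈)

  simplex-⊤ : ∀ {w} → Simplex r w → Rank T (suc d) (χ w ⊤)
  simplex-⊤ w∈ = rank (embedded w∈) (∣⊤∣≡n _)

  ∣φ∣ : ∀ {w} → Simplex r w → ∀ S → ∣ φ (χ w S) ∣ ≡ ∣ S ∣
  ∣φ∣ {w} w∈ S = ℕ.≤-antisym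
    (injection⇒∣∣≤ (λ u x → ℓ w x ≡ u) (φ (χ w S)) S (label⁻ w∈) (λ eq eq′ → trans (sym eq) eq′))
    (injection⇒∣∣≤ (λ x u → ℓ w x ≡ u) S (φ (χ w S)) (λ x∈ → _ , label⁺ w∈ x∈ , refl)
      (λ eq eq′ → ℓ-injective w∈ (trans eq (sym eq′))))

  -- Matched cells have the same final labels, so this shows that a match takes corners to corners.
  lower-corner : ∀ {w u} → Simplex r w → Simplex r u → ∀ {G S x} → T ∋ G ⊑ χ w S →
                 φ G ≡ φ (χ u ⁅ x ⁆) → ∃ λ y → y ∈ S × G ≡ χ w ⁅ y ⁆
  lower-corner {w} {u} w∈ u∈ {x = x} le eq with lower w∈ le
  ... | U , U⊆S , refl with label⁻ w∈ (subst (ℓ u x ∈_) (sym eq) (label⁺ u∈ (x∈⁅x⁆ x)))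
  ...   | y , y∈ , ℓy = y , U⊆S y∈ , cong (χ w) (⊆-antisym sub (⁅⁆⊆ y∈))
    where
    sub : U ⊆ ⁅ y ⁆
    sub {z} z∈ with label⁻ u∈ (subst (ℓ w z ∈_) eq (label⁺ w∈ z∈))
    ... | x′ , x′∈ , ℓx′ rewrite x∈⁅y⁆⇒x≡y x x′∈ | ℓ-injective w∈ (trans ℓy ℓx′) = x∈⁅x⁆ z

  -- The analogue for ridges, where counting labels is enough.
  lower-ridge : ∀ {w u} → Simplex r w → Simplex r u → ∀ {G a x y} → T ∋ G ⊑ χ w (facet a) →
                x ≢ y → φ G ≡ φ (χ u (ridge x y)) → ∃ λ b → b ≢ a × G ≡ χ w (ridge a b)
  lower-ridge {w} {u} w∈ u∈ {x = x} {y} le x≢y eq with lower w∈ le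
  ... | U , U⊆ , refl with ≡ridge U⊆ (trans (cong suc
          (trans (sym (∣φ∣ w∈ U)) (trans (cong ∣_∣ eq) (∣φ∣ u∈ (ridge x y))))) (suc∣ridge∣ x≢y))
  ...   | b , b≢a , refl = b , b≢a , refl

  glueing-sym : ∀ {h h′} → Glueing {T = T} r χ h h′ → Glueing {T = T} r χ h′ h
  glueing-sym (glueing w∈ v∈ a≢b c≢e other facet≡ ridge≡) =
    glueing v∈ w∈ c≢e a≢b (λ (e₁ , e₂) → other (sym e₁ , sym e₂)) (sym facet≡) (sym ridge≡)

  facet-colour : ∀ {w v a c} → Simplex r w → w ≡ v → χ w (facet a) ≡ χ v (facet c) → w ≡ v × a ≡ c
  facet-colour w∈ refl eq = refl , facet-injective (Embedding.injective (embedded w∈) eq)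

  -- Two different partners would put three simplices on one facet, against `thin`; the facet and
  -- the ridge then fix the colours.
  glueing-functional : ∀ {h h′ h″} → Glueing {T = T} r χ h h′ → Glueing {T = T} r χ h h″ → h′ ≡ h″
  glueing-functional (glueing w∈ v∈ a≢b c≢e other facet≡ ridge≡)
                     (glueing _ u∈ _ f≢g other′ facet≡′ ridge≡′)
    with thin w∈ v∈ u∈ facet≡ facet≡′
  ... | inj₁ w≡v = ⊥-elim (other (facet-colour w∈ w≡v facet≡))
  ... | inj₂ (inj₁ w≡u) = ⊥-elim (other′ (facet-colour w∈ w≡u facet≡′))
  ... | inj₂ (inj₂ v≡u) with facet-colour v∈ v≡u (trans (sym facet≡) facet≡′)
  ...   | refl , refl with ridge-injective f≢g
                             (Embedding.injective (embedded v∈) (trans (sym ridge≡) ridge≡′))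
  ...     | refl = refl

  module W = Walk swapHalf (λ _ → refl) (Glueing {T = T} r χ) glueing-sym glueing-functional

  record Located (σ F : Cell T) : Set where
    field
      w       : Word d
      a b     : Fin (suc d)
      w∈      : Simplex r w
      a≢b     : a ≢ b
      facet≡  : χ w (facet a) ≡ σ
      ridge≡  : χ w (ridge a b) ≡ F

  locate : 1 ≤ d → ∀ {σ F} → Rank T d σ → Rank T (d ∸ 1) F → T ∋ F ⊑ σ → Located σ F
  locate 1≤d {σ} {F} rσ rF F⊑σ with covered σ
  ... | w , w∈ , S , eq
    with ≡facet {p = S} (rank≡∣∣ (embedded w∈) (subst (Rank T d) (sym eq) rσ))
  ...   | a , refl with lower w∈ (subst (T ∋ F ⊑_) (sym eq) F⊑σ)
  ...     | U , U⊆ , eq′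
    with ≡ridge {p = U} U⊆ (trans (cong suc (rank≡∣∣ (embedded w∈)
                                              (subst (Rank T (d ∸ 1)) (sym eq′) rF)))
                              (ℕ.m+[n∸m]≡n 1≤d))
  ...       | b , b≢a , refl = record
              { w∈ = w∈ ; a≢b = b≢a ∘ sym ; facet≡ = eq ; ridge≡ = eq′ }

module Zip {d V T T′} {r : Code d} {χ : Word d → Subset (suc d) → Cell T}
           {ℓ : Word d → Fin (suc d) → Fin V}
           (i : Identify d T T′) (p : Presented T r χ)
           (l′ : Labelled ℓ r T′ (λ w S → Identify.quot i (χ w S)))
           (inv : Invariant r T χ)
           (at-σ : LabelFacts.Located p (pullback (Identify.quot i) l′) (Identify.σ i) (Identify.F i))
           (at-τ : LabelFacts.Located p (pullback (Identify.quot i) l′) (Identify.τ i) (Identify.F i))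
           where

  open Identify i
  open LabelFacts p (pullback quot l′)
  open Presented p
  open Labelled (pullback {T = T} {χ = χ} quot l′)
  open Quotient i
  module I = Invariant inv
  open Located at-σ using ()
    renaming (w to w₀; a to a₀; b to b₀; w∈ to w₀∈; a≢b to a₀≢b₀; facet≡ to σ≡; ridge≡ to Fσ≡)
  open Located at-τ using ()
    renaming (w to v₀; a to c₀; b to e₀; w∈ to v₀∈; a≢b to c₀≢e₀; facet≡ to τ≡; ridge≡ to Fτ≡)

  χ′ : Word d → Subset (suc d) → Cell T′
  χ′ w S = quot (χ w S)

  private
    module Eσ = Embedding (ChartProperties.embedding T σ-chart)
    module Eτ = Embedding (ChartProperties.embedding T τ-chart)

  φ-match : ∀ {G H} → Match G H → φ G ≡ φ H
  φ-match m = cong (Labelled.φ l′) (quot-≡ m)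

  match-⊑σ : ∀ {G H} → Match G H → T ∋ G ⊑ χ w₀ (facet a₀)
  match-⊑σ (S , refl , _) = subst (T ∋ _ ⊑_) (sym σ≡) (ChartProperties.cell⊑ T σ-chart S)

  match-⊑τ : ∀ {G H} → Match G H → T ∋ H ⊑ χ v₀ (facet c₀)
  match-⊑τ (S , _ , refl) = subst (T ∋ _ ⊑_) (sym τ≡) (ChartProperties.cell⊑ T τ-chart S)

  match-στ : Match (χ w₀ (facet a₀)) (χ v₀ (facet c₀))
  match-στ = ⊤ , trans (ChartProperties.top T σ-chart) (sym σ≡) ,
                 trans (ChartProperties.top T τ-chart) (sym τ≡)

  match-fixedˡ : ∀ {G H} → Match G H → T ∋ G ⊑ F → G ≡ H
  match-fixedˡ (S , refl , refl) le = sym (fixes-F S le)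

  -- Fixing is given for faces of σ. Here `τ.cell S` lies below F, hence is some `σ.cell U`; this is
  -- fixed, so `τ.cell U` equals `τ.cell S` and U is S.
  match-fixedʳ : ∀ {G H} → Match G H → T ∋ H ⊑ F → G ≡ H
  match-fixedʳ (S , refl , refl) le with ChartProperties.below T σ-chart (⊑-trans T le F⊑σ)
  ... | U , eq = trans (cong σ.cell (sym (Eτ.injective
                   (trans (fixes-F U (subst (T ∋_⊑ F) (sym eq) le)) eq)))) eq

  σ-free : ∀ {u f} → Simplex r u → χ w₀ (facet a₀) ≡ χ u (facet f) → w₀ ≡ u × a₀ ≡ f
  σ-free {u} {f} u∈ eq = facet-colour w₀∈ (distinct w₀∈ u∈ (cong φ
    (boundary⇒≡ {T = T} σ-chart σ-boundary
    (simplex-⊤ w₀∈) (simplex-⊤ u∈) (subst (T ∋_⊑ χ w₀ ⊤) σ≡ (mono w₀∈ ⊆⊤))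
    (subst (T ∋_⊑ χ u ⊤) (trans (sym eq) σ≡) (mono u∈ ⊆⊤))))) eq

  τ-free : ∀ {u f} → Simplex r u → χ v₀ (facet c₀) ≡ χ u (facet f) → v₀ ≡ u × c₀ ≡ f
  τ-free {u} {f} u∈ eq = facet-colour v₀∈ (distinct v₀∈ u∈ (cong φ
    (boundary⇒≡ {T = T} τ-chart τ-boundary
    (simplex-⊤ v₀∈) (simplex-⊤ u∈) (subst (T ∋_⊑ χ v₀ ⊤) τ≡ (mono v₀∈ ⊆⊤))
    (subst (T ∋_⊑ χ u ⊤) (trans (sym eq) τ≡) (mono u∈ ⊆⊤))))) eq

  Free : Word d → Fin (suc d) → Set
  Free w a = ¬ GluedFacet {T = T} r χ w a

  free-σ : Free w₀ a₀
  free-σ (u , f , u∈ , ne , eq) = ne (σ-free u∈ eq)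

  free-τ : Free v₀ c₀
  free-τ (u , f , u∈ , ne , eq) = ne (τ-free u∈ eq)

  σ≢τ′ : ¬ (w₀ ≡ v₀ × a₀ ≡ c₀)
  σ≢τ′ (w≡ , a≡) = σ≢τ (trans (sym σ≡) (trans (cong₂ (λ w a → χ w (facet a)) w≡ a≡) τ≡))

  marked-glued : ∀ {w a b} → Marked I.code w a b → GluedFacet {T = T} r χ w a
  marked-glued m = I.closed m (I.simplex⁻ (marked-simplex m)) (marked-≢ m ∘ sym) refl

  -- Any other kind would make the facet glued: to a child, to the parent if the address is void,
  -- or, if it is marked, by `closed` at its own ridge.
  vacant : ∀ {w a} → Simplex r w → Free w a → kindAt I.code (w ∷ʳ a) ≡ none
  vacant {w} {a} w∈ free with kindAt I.code (w ∷ʳ a) in eq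
  ... | none = refl
  ... | mark m = ⊥-elim (free (marked-glued (marked eq refl)))
  ... | child = ⊥-elim (free (w ∷ʳ a , a , I.simplex⁻ (simplex eq) , w≢w∷ʳa ∘ proj₁ ,
                               I.tree (I.simplex⁻ (simplex eq)) (∉facet a)))
  ... | void with kindAt-void I.code w a (Simplex.child-at (I.simplex⁺ w∈)) eq
  ...   | v , refl =
    ⊥-elim (free (v , a , parent w∈ , w≢w∷ʳa ∘ sym ∘ proj₁ , sym (I.tree w∈ (∉facet a))))

  module M₁ = Marking (marking I.code w₀ (vacant w₀∈ free-σ) a₀≢b₀)
  module M₂ = Marking (marking M₁.code v₀ (M₁.vacant (vacant v₀∈ free-τ) σ≢τ′) c₀≢e₀)

  same-old : ∀ {w x v y} → Same I.code w x v y → Same M₂.code w x v y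
  same-old = same-map (M₂.simplex⁺ ∘ M₁.simplex⁺) (M₂.marked-old ∘ M₁.marked-old)

  same-cell : ∀ {w v} → Simplex r w → Simplex r v → ∀ {x y} →
              χ w ⁅ x ⁆ ≡ χ v ⁅ y ⁆ → Same M₂.code w x v y
  same-cell w∈ v∈ eq = same-old (I.complete w∈ v∈ eq)

  ridge-vertex : ∀ {w v} → Simplex r w → Simplex r v → ∀ {a b c e} →
                 χ w (ridge a b) ≡ χ v (ridge c e) →
                 ∀ {x} → x ∈ ridge a b → ∃ λ y → y ∈ ridge c e × Same M₂.code w x v y
  ridge-vertex {w} w∈ v∈ eq {x} x∈
    with lower-corner v∈ w∈ (subst (T ∋ χ w ⁅ x ⁆ ⊑_) eq (mono w∈ (⁅⁆⊆ x∈))) refl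
  ... | y , y∈ , eq′ = y , y∈ , same-cell w∈ v∈ eq′

  zipped : Same M₂.code w₀ b₀ v₀ e₀
  zipped = same-zip (M₂.marked-old M₁.marked-new) M₂.marked-new σ≢τ′
    (ridge-vertex w₀∈ v₀∈ (trans Fσ≡ (sym Fτ≡)))
    (λ y∈ → let x , x∈ , s = ridge-vertex v₀∈ w₀∈ (trans Fτ≡ (sym Fσ≡)) y∈ in x , x∈ , same-sym s)

  vertex⊑Fσ : ∀ {x} → x ≢ a₀ → x ≢ b₀ → T ∋ χ w₀ ⁅ x ⁆ ⊑ F
  vertex⊑Fσ {x} x≢a x≢b = subst (T ∋ χ w₀ ⁅ x ⁆ ⊑_) Fσ≡ (mono w₀∈ (⁅⁆⊆ (∈ridge⁺ x≢a x≢b)))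

  vertex⊑Fτ : ∀ {x} → x ≢ c₀ → x ≢ e₀ → T ∋ χ v₀ ⁅ x ⁆ ⊑ F
  vertex⊑Fτ {x} x≢c x≢e = subst (T ∋ χ v₀ ⁅ x ⁆ ⊑_) Fτ≡ (mono v₀∈ (⁅⁆⊆ (∈ridge⁺ x≢c x≢e)))

  -- A corner of σ or τ other than its apex lies in F and is fixed; the two apices are what the new
  -- pair of marks identifies.
  same-match : ∀ {x y} → x ≢ a₀ → y ≢ c₀ → Match (χ w₀ ⁅ x ⁆) (χ v₀ ⁅ y ⁆) → Same M₂.code w₀ x v₀ y
  same-match {x} {y} x≢a y≢c m with x ≟ b₀
  ... | no x≢b = same-cell w₀∈ v₀∈ (match-fixedˡ m (vertex⊑Fσ x≢a x≢b))
  ... | yes refl with y ≟ e₀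
  ...   | no y≢e = same-cell w₀∈ v₀∈ (match-fixedʳ m (vertex⊑Fτ y≢c y≢e))
  ...   | yes refl = zipped

  -- Each match leads from a corner of σ to a corner of τ or back; before, between and after the
  -- matches the cells are equal already in T.
  complete-chain : ∀ {G v y} → Simplex r v → EqClosure Match G (χ v ⁅ y ⁆) →
                   ∀ {w x} → Simplex r w → χ w ⁅ x ⁆ ≡ G → Same M₂.code w x v y
  complete-chain v∈ ε w∈ eq = same-cell w∈ v∈ eq
  complete-chain v∈ (fwd m ◅ ms) w∈ refl
    with lower-corner w₀∈ w∈ (match-⊑σ m) refl | lower-corner v₀∈ w∈ (match-⊑τ m) (sym (φ-match m))
  ... | x₀ , x₀∈ , eq | y₀ , y₀∈ , refl =
    same-trans (same-cell w∈ w₀∈ eq)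
      (same-trans (same-match (∈facet⁻ x₀∈) (∈facet⁻ y₀∈) (subst (λ G → Match G (χ v₀ ⁅ y₀ ⁆)) eq m))
        (complete-chain v∈ ms v₀∈ refl))
  complete-chain v∈ (bwd m ◅ ms) w∈ refl
    with lower-corner w₀∈ w∈ (match-⊑σ m) (φ-match m) | lower-corner v₀∈ w∈ (match-⊑τ m) refl
  ... | x₀ , x₀∈ , refl | y₀ , y₀∈ , eq =
    same-trans (same-cell w∈ v₀∈ eq)
      (same-trans (same-sym (same-match (∈facet⁻ x₀∈) (∈facet⁻ y₀∈) (subst (Match _) eq m)))
        (complete-chain v∈ ms w₀∈ refl))

  glueing-quot : ∀ {h h′} → Glueing {T = T} r χ h h′ → Glueing {T = T′} r χ′ h h′
  glueing-quot (glueing w∈ v∈ a≢b c≢e other facet≡ ridge≡) =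
    glueing w∈ v∈ a≢b c≢e other (cong quot facet≡) (cong quot ridge≡)

  path-quot : ∀ {h h′} → Path {T = T} r χ h h′ → Path {T = T′} r χ′ h h′
  path-quot = Star.map λ where
    (inj₁ eq) → inj₁ eq
    (inj₂ g)  → inj₂ (glueing-quot g)

  glued-quot : ∀ {w a} → GluedFacet {T = T} r χ w a → GluedFacet {T = T′} r χ′ w a
  glued-quot (v , c , v∈ , other , eq) = v , c , v∈ , other , cong quot eq

  new-glueing : ∀ {x y} → x ≢ a₀ → y ≢ c₀ → Match (χ w₀ (ridge a₀ x)) (χ v₀ (ridge c₀ y)) →
                Glueing {T = T′} r χ′ (w₀ , a₀ , x) (v₀ , c₀ , y)
  new-glueing x≢a y≢c m =
    glueing w₀∈ v₀∈ (x≢a ∘ sym) (y≢c ∘ sym) σ≢τ′ (quot-≡ match-στ) (quot-≡ m)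

  new-glueing-sym : ∀ {x y} → x ≢ a₀ → y ≢ c₀ → Match (χ w₀ (ridge a₀ x)) (χ v₀ (ridge c₀ y)) →
                    Glueing {T = T′} r χ′ (v₀ , c₀ , y) (w₀ , a₀ , x)
  new-glueing-sym x≢a y≢c m =
    glueing v₀∈ w₀∈ (y≢c ∘ sym) (x≢a ∘ sym) (λ (e₁ , e₂) → σ≢τ′ (sym e₁ , sym e₂))
      (sym (quot-≡ match-στ)) (sym (quot-≡ m))

  connected-chain : ∀ {G v c e} → Simplex r v → c ≢ e → EqClosure Match G (χ v (ridge c e)) →
                    ∀ {w a b} → Simplex r w → a ≢ b → χ w (ridge a b) ≡ G →
                    Path {T = T′} r χ′ (w , a , b) (v , c , e)
  connected-chain v∈ c≢e ε w∈ a≢b eq = path-quot (I.connected w∈ v∈ a≢b c≢e eq)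
  connected-chain v∈ c≢e (fwd m ◅ ms) w∈ a≢b refl
    with lower-ridge w₀∈ w∈ (match-⊑σ m) a≢b refl
       | lower-ridge v₀∈ w∈ (match-⊑τ m) a≢b (sym (φ-match m))
  ... | x₀ , x₀≢ , eq | y₀ , y₀≢ , refl =
    path-quot (I.connected w∈ w₀∈ a≢b (x₀≢ ∘ sym) eq) ◅◅
    inj₂ (new-glueing x₀≢ y₀≢ (subst (λ G → Match G (χ v₀ (ridge c₀ y₀))) eq m)) ◅
    connected-chain v∈ c≢e ms v₀∈ (y₀≢ ∘ sym) refl
  connected-chain v∈ c≢e (bwd m ◅ ms) w∈ a≢b refl
    with lower-ridge w₀∈ w∈ (match-⊑σ m) a≢b (φ-match m)
       | lower-ridge v₀∈ w∈ (match-⊑τ m) a≢b refl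
  ... | x₀ , x₀≢ , refl | y₀ , y₀≢ , eq =
    path-quot (I.connected w∈ v₀∈ a≢b (y₀≢ ∘ sym) eq) ◅◅
    inj₂ (new-glueing-sym x₀≢ y₀≢ (subst (Match _) eq m)) ◅
    connected-chain v∈ c≢e ms w₀∈ (x₀≢ ∘ sym) refl

  -- All facets around a marked ridge are glued already, so that later
  -- identifications do not touch it.
  marked-fixed : ∀ {w a b G} → Marked I.code w a b →
                 quot (χ w (ridge a b)) ≡ quot G → χ w (ridge a b) ≡ G
  marked-fixed {w} {a} {b} {G} m eq = go (Equivalence.to (kernel _ _) eq)
    where
    w∈ = I.simplex⁻ (marked-simplex m)
    go : EqClosure Match (χ w (ridge a b)) G → χ w (ridge a b) ≡ G
    go ε = refl
    go (fwd m′ ◅ _) with lower-ridge w₀∈ w∈ (match-⊑σ m′) (marked-≢ m ∘ sym) refl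
    ... | x₀ , x₀≢ , eq = ⊥-elim (free-σ (I.closed m w₀∈ (x₀≢ ∘ sym) eq))
    go (bwd m′ ◅ _) with lower-ridge v₀∈ w∈ (match-⊑τ m′) (marked-≢ m ∘ sym) refl
    ... | y₀ , y₀≢ , eq = ⊥-elim (free-τ (I.closed m v₀∈ (y₀≢ ∘ sym) eq))

  F-chain : ∀ {G H} → EqClosure Match G H → G ≡ F → G ≡ H
  F-chain ε eq = refl
  F-chain (fwd m ◅ ms) refl with match-fixedˡ m (⊑-refl T)
  ... | refl = F-chain ms refl
  F-chain (bwd m ◅ ms) refl with match-fixedʳ m (⊑-refl T)
  ... | refl = F-chain ms refl

  F-fixed : ∀ {G} → quot F ≡ quot G → F ≡ G
  F-fixed eq = F-chain (Equivalence.to (kernel _ _) eq) refl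

  -- If b₀ were matched with a corner of τ other than e₀, that corner would lie in F and be fixed,
  -- which puts b₀ itself into F.
  apex-match : χ′ w₀ ⁅ b₀ ⁆ ≡ χ′ v₀ ⁅ e₀ ⁆
  apex-match with ChartProperties.below T σ-chart
                    (subst (T ∋ χ w₀ ⁅ b₀ ⁆ ⊑_) σ≡ (mono w₀∈ (⁅⁆⊆ (∈facet⁺ (a₀≢b₀ ∘ sym)))))
  ... | U , eq with lower-corner v₀∈ w₀∈ (match-⊑τ (U , refl , refl))
                      (trans (sym (φ-match (U , refl , refl))) (cong φ eq))
  ...   | y , y∈ , eq′ with y ≟ e₀
  ...     | yes refl = trans (cong quot (sym eq)) (trans (quot-≡ (U , refl , refl)) (cong quot eq′))
  ...     | no y≢e = ⊥-elim (proj₂ (∈ridge⁻ (b∈ (x∈⁅x⁆ b₀))) refl)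
    where
    H⊑F : T ∋ τ.cell U ⊑ F
    H⊑F = subst (T ∋_⊑ F) (sym eq′) (vertex⊑Fτ (∈facet⁻ y∈) y≢e)
    b∈ : ⁅ b₀ ⁆ ⊆ ridge a₀ b₀
    b∈ = Embedding.reflects (embedded w₀∈)
      (subst₂ (T ∋_⊑_) (trans (sym (match-fixedʳ (U , refl , refl) H⊑F)) eq) (sym Fσ≡) H⊑F)

  free-half : ∀ {w a b} → Free w a → ¬ W.Glued (w , a , b)
  free-half free ((v , c , e) , glueing w∈ v∈ a≢b c≢e other facet≡ ridge≡) =
    free (v , c , v∈ , other , facet≡)

  -- By the walk around F, its only free facets are σ and τ.
  closed-F : ∀ {v c e} → Simplex r v → c ≢ e → F ≡ χ v (ridge c e) → GluedFacet {T = T′} r χ′ v c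
  closed-F {v} {c} {e} v∈ c≢e eq with W.two-ends (free-half free-σ) (free-half free-τ)
         (λ h≡ → σ≢τ′ (cong proj₁ h≡ , cong (proj₁ ∘ proj₂) h≡))
         (I.connected w₀∈ v₀∈ a₀≢b₀ c₀≢e₀ (trans Fσ≡ (sym Fτ≡)))
         (I.connected w₀∈ v∈ a₀≢b₀ c≢e (trans Fσ≡ eq))
  ... | inj₁ refl = v₀ , c₀ , v₀∈ , σ≢τ′ , quot-≡ match-στ
  ... | inj₂ (inj₁ refl) =
    w₀ , a₀ , w₀∈ , (λ (e₁ , e₂) → σ≢τ′ (sym e₁ , sym e₂)) , sym (quot-≡ match-στ)
  ... | inj₂ (inj₂ ((u , f , g) , glueing _ u∈ _ _ other facet≡ _)) =
    u , f , u∈ , other , cong quot facet≡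

  data MarkedCases (w : Word d) (a b : Fin (suc d)) : Set where
    at-σ′ : w ≡ w₀ → a ≡ a₀ → b ≡ b₀ → MarkedCases w a b
    at-τ′ : w ≡ v₀ → a ≡ c₀ → b ≡ e₀ → MarkedCases w a b
    old   : Marked I.code w a b → MarkedCases w a b

  marked-cases : ∀ {w a b} → Marked M₂.code w a b → MarkedCases w a b
  marked-cases m with M₂.marked-cases m
  ... | inj₁ (e₁ , e₂ , e₃) = at-τ′ e₁ e₂ e₃
  ... | inj₂ m′ with M₁.marked-cases m′
  ...   | inj₁ (e₁ , e₂ , e₃) = at-σ′ e₁ e₂ e₃
  ...   | inj₂ m″ = old m″

  -- An earlier marked ridge has not moved, so it would already have been F; then σ would be glued
  -- before this step.
  old-σ : ∀ {w a b} → Marked I.code w a b → χ′ w (ridge a b) ≢ χ′ w₀ (ridge a₀ b₀)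
  old-σ m eq = free-σ (I.closed m w₀∈ a₀≢b₀ (marked-fixed m eq))

  old-τ : ∀ {w a b} → Marked I.code w a b → χ′ w (ridge a b) ≢ χ′ v₀ (ridge c₀ e₀)
  old-τ m eq = free-τ (I.closed m v₀∈ c₀≢e₀ (marked-fixed m eq))

  partner′ : ∀ {w a b v c e} → MarkedCases w a b → MarkedCases v c e →
             χ′ w (ridge a b) ≡ χ′ v (ridge c e) →
             (w ≡ v × a ≡ c) ⊎ χ′ w ⁅ b ⁆ ≡ χ′ v ⁅ e ⁆
  partner′ (at-σ′ refl refl refl) (at-σ′ refl refl refl) eq = inj₁ (refl , refl)
  partner′ (at-σ′ refl refl refl) (at-τ′ refl refl refl) eq = inj₂ apex-match
  partner′ (at-τ′ refl refl refl) (at-σ′ refl refl refl) eq = inj₂ (sym apex-match)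
  partner′ (at-τ′ refl refl refl) (at-τ′ refl refl refl) eq = inj₁ (refl , refl)
  partner′ (at-σ′ refl refl refl) (old m) eq = ⊥-elim (old-σ m (sym eq))
  partner′ (at-τ′ refl refl refl) (old m) eq = ⊥-elim (old-τ m (sym eq))
  partner′ (old m) (at-σ′ refl refl refl) eq = ⊥-elim (old-σ m eq)
  partner′ (old m) (at-τ′ refl refl refl) eq = ⊥-elim (old-τ m eq)
  partner′ (old m) (old m′) eq with I.partner m m′ (marked-fixed m eq)
  ... | inj₁ same = inj₁ same
  ... | inj₂ apex = inj₂ (cong quot apex)

  closed′ : ∀ {w a b v c e} → MarkedCases w a b → Simplex r v → c ≢ e →
            χ′ w (ridge a b) ≡ χ′ v (ridge c e) → GluedFacet {T = T′} r χ′ v c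
  closed′ (at-σ′ refl refl refl) v∈ c≢e eq = closed-F v∈ c≢e (F-fixed (trans (cong quot (sym Fσ≡)) eq))
  closed′ (at-τ′ refl refl refl) v∈ c≢e eq = closed-F v∈ c≢e (F-fixed (trans (cong quot (sym Fτ≡)) eq))
  closed′ (old m) v∈ c≢e eq = glued-quot (I.closed m v∈ c≢e (marked-fixed m eq))

  invariant : Invariant r T′ χ′
  invariant = record
    { code      = M₂.code
    ; simplex⁺  = M₂.simplex⁺ ∘ M₁.simplex⁺ ∘ I.simplex⁺
    ; simplex⁻  = I.simplex⁻ ∘ M₁.simplex⁻ ∘ M₂.simplex⁻
    ; size      = trans M₂.size (trans M₁.size I.size)
    ; tree      = λ w∈ a∉ → cong quot (I.tree w∈ a∉)
    ; complete  = λ w∈ v∈ eq → complete-chain v∈ (Equivalence.to (kernel _ _) eq) w∈ refl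
    ; connected = λ w∈ v∈ a≢b c≢e eq →
        connected-chain v∈ c≢e (Equivalence.to (kernel _ _) eq) w∈ a≢b refl
    ; partner   = λ m m′ → partner′ (marked-cases m) (marked-cases m′)
    ; closed    = λ m → closed′ (marked-cases m)
    }

zip-invariant : ∀ {d V T T′} {r : Code d} {χ} {ℓ : Word d → Fin (suc d) → Fin V} → 1 ≤ d →
                (i : Identify d T T′) → Presented T r χ →
                Labelled ℓ r T′ (λ w S → Identify.quot i (χ w S)) →
                Invariant r T χ → Invariant r T′ (λ w S → Identify.quot i (χ w S))
zip-invariant 1≤d i p l′ inv =
  Zip.invariant i p l′ inv (locate 1≤d σ-chart F-rank F⊑σ) (locate 1≤d τ-chart F-rank F⊑τ)
  where
  open Identify i
  open LabelFacts p (pullback quot l′)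

final-invariant : ∀ {d V T T′} {r : Code d} {χ} {ℓ : Word d → Fin (suc d) → Fin V} → 1 ≤ d →
                  (is : Identifications d T T′) → Presented T r χ →
                  Labelled ℓ r T′ (λ w S → quotient is (χ w S)) →
                  Invariant r T χ → Invariant r T′ (λ w S → quotient is (χ w S))
final-invariant 1≤d done p l inv = inv
final-invariant 1≤d (i ▸ is) p l inv =
  final-invariant 1≤d is (Quotient.quotient-presented i p) l
    (zip-invariant 1≤d i p (pullback (quotient is) l) inv)

-- Codes determine complexes

-- The vertices of C are the classes of the corners of the simplices of r
-- under the identifications prescribed by r, and its facets are the
-- simplices of r.
record Encodes {d} (N : ℕ) (C : SimplicialComplex) (r : Code d) : Set where
  open SimplicialComplex C
  field
    size   : suc (children r) ≡ N
    ℓ      : Word d → Fin (suc d) → Fin V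
    onto   : ∀ u → ∃ λ w → Simplex r w × ∃ λ x → ℓ w x ≡ u
    kernel⁺ : ∀ {w v} → Simplex r w → Simplex r v → ∀ {x y} → ℓ w x ≡ ℓ v y → Same r w x v y
    kernel⁻ : ∀ {w x v y} → Same r w x v y → ℓ w x ≡ ℓ v y
    faces⁺ : ∀ {S} → Face S → ∃ λ w → Simplex r w × (∀ {u} → u ∈ S → ∃ λ x → ℓ w x ≡ u)
    faces⁻ : ∀ {S w} → Simplex r w → (∀ {u} → u ∈ S → ∃ λ x → ℓ w x ≡ u) → Face S

module _ {d N C C′} {r : Code d} (E : Encodes N C r) (E′ : Encodes N C′ r) where
  private
    module E  = Encodes E
    module E′ = Encodes E′

  transfer : Fin (SimplicialComplex.V C) → Fin (SimplicialComplex.V C′)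
  transfer u = let w , _ , x , _ = E.onto u in E′.ℓ w x

  transfer-ℓ : ∀ {w} → Simplex r w → ∀ x → transfer (E.ℓ w x) ≡ E′.ℓ w x
  transfer-ℓ {w} w∈ x with E.onto (E.ℓ w x)
  ... | v , v∈ , y , eq = E′.kernel⁻ (E.kernel⁺ v∈ w∈ eq)

transfer-inverse : ∀ {d N C C′} {r : Code d} (E : Encodes N C r) (E′ : Encodes N C′ r) →
                   ∀ u → transfer E′ E (transfer E E′ u) ≡ u
transfer-inverse E E′ u with Encodes.onto E u
... | w , w∈ , x , refl = transfer-ℓ E′ E w∈ x

encodes⇒isomorphic : ∀ {d N C C′} {r : Code d} → Encodes N C r → Encodes N C′ r → Isomorphic C C′
encodes⇒isomorphic {C = C} {C′} E E′ =
  permutation to from (transfer-inverse E′ E) (transfer-inverse E E′) , λ S → mk⇔ (forth S) (back S)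
  where
  module E  = Encodes E
  module E′ = Encodes E′
  to = transfer E E′
  from = transfer E′ E

  Pulled : Subset (SimplicialComplex.V C′) → Subset (SimplicialComplex.V C)
  Pulled S = tabulate λ v → lookup S (to v)

  forth : ∀ S → SimplicialComplex.Face C′ S → SimplicialComplex.Face C (Pulled S)
  forth S F with E′.faces⁺ F
  ... | w , w∈ , cover = E.faces⁻ w∈ λ {u} u∈ → cover′ (cover (Vec.lookup⇒[]= (to u) S
          (trans (sym (Vec.lookup∘tabulate (λ v → lookup S (to v)) u)) (Vec.[]=⇒lookup u∈))))
    where
    cover′ : ∀ {u} → (∃ λ x → E′.ℓ w x ≡ to u) → ∃ λ x → E.ℓ w x ≡ u
    cover′ {u} (x , eq) = x , trans (sym (transfer-ℓ E′ E w∈ x))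
                                (trans (cong from eq) (transfer-inverse E E′ u))

  back : ∀ S → SimplicialComplex.Face C (Pulled S) → SimplicialComplex.Face C′ S
  back S F with E.faces⁺ F
  ... | w , w∈ , cover = E′.faces⁻ w∈ λ {u} u∈ → cover′ (cover (Vec.lookup⇒[]= (from u) (Pulled S)
          (trans (Vec.lookup∘tabulate (λ v → lookup S (to v)) (from u))
            (trans (cong (lookup S) (transfer-inverse E′ E u)) (Vec.[]=⇒lookup u∈)))))
    where
    cover′ : ∀ {u} → (∃ λ x → E.ℓ w x ≡ from u) → ∃ λ x → E′.ℓ w x ≡ u
    cover′ {u} (x , eq) = x , trans (sym (transfer-ℓ E E′ w∈ x))
                                (trans (cong to eq) (transfer-inverse E′ E u))

module _ {d N} (C : SimplicialComplex) (lc : IsLC d N C) (1≤d : 1 ≤ d) where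
  open IsLC lc
  open LocalConstruction construction

  private
    initial : TreeOfSimplices {d} (T N) N
    initial = start-at N 1≤N ℕ.≤-refl
      where
      start-at : ∀ n → 1 ≤ n → n ≤ N → TreeOfSimplices {d} (T n) n
      start-at (suc n) _ n≤N = glueTrees T start glue n n≤N

    module t = TreeOfSimplices initial

    is : Identifications d (T N) (T k)
    is = identifications T identify (k ∸ N) N ℕ.≤-refl (ℕ.m+[n∸m]≡n N≤k)

    χ : Word d → Subset (suc d) → Cell (T k)
    χ w S = quotient is (t.χ w S)

    p : Presented (T k) t.code χ
    p = presented is (tree-presented initial)

    module L = FinalLabels C facets (pseudomanifold k (ℕ.≤-trans 1≤N N≤k) ℕ.≤-refl) end p t.listed

    module I = Invariant (final-invariant 1≤d is (tree-presented initial) L.labelled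
                            (TreeInvariant.invariant initial))

    open SimplicialComplex C

    label-≡ : ∀ {w v} → Simplex t.code w → Simplex t.code v → ∀ {x y} →
              χ w ⁅ x ⁆ ≡ χ v ⁅ y ⁆ → L.ℓ w x ≡ L.ℓ v y
    label-≡ w∈ v∈ {x} {y} eq = x∈⁅y⁆⇒x≡y _ (subst (L.ℓ _ x ∈_)
      (trans (sym (L.ℓ-spec w∈ x)) (trans (cong L.f eq) (L.ℓ-spec v∈ y))) (x∈⁅x⁆ _))

    cell-≡ : ∀ {w v} → Simplex t.code w → Simplex t.code v → ∀ {x y} →
             L.ℓ w x ≡ L.ℓ v y → χ w ⁅ x ⁆ ≡ χ v ⁅ y ⁆
    cell-≡ w∈ v∈ {x} {y} eq =
      L.f-injective (trans (L.ℓ-spec w∈ x) (trans (cong ⁅_⁆ eq) (sym (L.ℓ-spec v∈ y))))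

    ⊆-labels : ∀ {w v} → Simplex t.code w → Simplex t.code v → ∀ {S U} →
              (∀ {x} → x ∈ S → ∃ λ y → y ∈ U × L.ℓ w x ≡ L.ℓ v y) → L.f (χ w S) ⊆ L.f (χ v U)
    ⊆-labels w∈ v∈ h u∈ with L.label⁻ w∈ u∈
    ... | x , x∈ , refl with h x∈
    ...   | y , y∈ , eq = subst (_∈ L.f _) (sym eq) (L.label⁺ v∈ y∈)

    -- For two marks, the induction hypothesis gives their ridges equal label sets, so they are the
    -- same cell of the final complex; `partner` then identifies the apices.
    sound : ∀ {w x v y} → Same I.code w x v y → L.ℓ w x ≡ L.ℓ v y
    sound same-refl = refl
    sound (same-sym s) = sym (sound s)
    sound (same-trans s s′) = trans (sound s) (sound s′)
    sound (same-tree wa∈ x≢a) =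
      label-≡ (parent wa∈′) wa∈′ (I.tree wa∈′ λ a∈ → x≢a (sym (x∈⁅y⁆⇒x≡y _ a∈)))
      where wa∈′ = I.simplex⁻ wa∈
    sound (same-zip {w} {a} {b} {v} {c} {e} m m′ other to from)
      with I.partner m m′ (L.f-injective (⊆-antisym
             (⊆-labels w∈ v∈ λ x∈ → let y , y∈ , s = to x∈ in y , y∈ , sound s)
             (⊆-labels v∈ w∈ λ y∈ → let x , x∈ , s = from y∈ in x , x∈ , sym (sound s))))
      where
      w∈ = I.simplex⁻ (marked-simplex m)
      v∈ = I.simplex⁻ (marked-simplex m′)
    ... | inj₁ same = ⊥-elim (other same)
    ... | inj₂ apex = label-≡ (I.simplex⁻ (marked-simplex m)) (I.simplex⁻ (marked-simplex m′)) apex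

    onto : ∀ u → ∃ λ w → Simplex t.code w × ∃ λ x → L.ℓ w x ≡ u
    onto u with L.face (vertices u)
    ... | G , fG with Presented.covered p G
    ...   | w , w∈ , S , refl with L.label⁻ w∈ (subst (u ∈_) (sym fG) (x∈⁅x⁆ u))
    ...     | x , _ , eq = w , w∈ , x , eq

    faces⁺ : ∀ {S} → Face S → ∃ λ w → Simplex t.code w × (∀ {u} → u ∈ S → ∃ λ x → L.ℓ w x ≡ u)
    faces⁺ F with L.face F
    ... | G , refl with Presented.covered p G
    ...   | w , w∈ , S , refl = w , w∈ , λ u∈ → let x , _ , eq = L.label⁻ w∈ u∈ in x , eq

    faces⁻ : ∀ {S w} → Simplex t.code w → (∀ {u} → u ∈ S → ∃ λ x → L.ℓ w x ≡ u) → Face S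
    faces⁻ {w = w} w∈ cover = closed
      (λ u∈ → let x , eq = cover u∈ in subst (_∈ L.f (χ w ⊤)) eq (L.label⁺ w∈ ∈⊤))
      (Equivalence.from (proj₂ (proj₂ end) _) (χ w ⊤ , refl))

  encode : ∃ λ (r : Code d) → Encodes N C r
  encode = I.code , record
    { size = trans (cong suc I.size) t.size
    ; ℓ = L.ℓ
    ; onto = λ u → let w , w∈ , rest = onto u in w , I.simplex⁺ w∈ , rest
    ; kernel⁺ = λ w∈ v∈ eq → I.complete (I.simplex⁻ w∈) (I.simplex⁻ v∈)
                               (cell-≡ (I.simplex⁻ w∈) (I.simplex⁻ v∈) eq)
    ; kernel⁻ = sound
    ; faces⁺ = λ F → let w , w∈ , rest = faces⁺ F in w , I.simplex⁺ w∈ , rest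
    ; faces⁻ = λ w∈ → faces⁻ (I.simplex⁻ w∈)
    }

-- Counting

module _ {k : ℕ} where

  word-index : ∀ {n} → Vec (Fin k) n → Fin (k ^ n)
  word-index []       = zero
  word-index (x ∷ xs) = combine x (word-index xs)

  word-index-injective : ∀ {n} (xs ys : Vec (Fin k) n) → word-index xs ≡ word-index ys → xs ≡ ys
  word-index-injective [] [] eq = refl
  word-index-injective (x ∷ xs) (y ∷ ys) eq
    with Fin.combine-injective x (word-index xs) y (word-index ys) eq
  ... | refl , eq′ = cong (x ∷_) (word-index-injective xs ys eq′)

  word-at : ∀ n → Fin (k ^ n) → Vec (Fin k) n
  word-at zero    i = []
  word-at (suc n) i = let x , j = remQuot (k ^ n) i in x ∷ word-at n j

  word-at-injective : ∀ n {i j} → word-at n i ≡ word-at n j → i ≡ j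
  word-at-injective zero {zero} {zero} eq = refl
  word-at-injective (suc n) {i} {j} eq =
    trans (sym (Fin.combine-remQuot {k} (k ^ n) i))
      (trans (cong₂ combine (proj₁ (Vec.∷-injective eq))
                            (word-at-injective n (proj₂ (Vec.∷-injective eq))))
        (Fin.combine-remQuot {k} (k ^ n) j))

toList-injective : ∀ {A : Set} {n} {xs ys : Vec A n} → toList xs ≡ toList ys → xs ≡ ys
toList-injective {xs = xs} {ys} eq =
  trans (sym (Vec.cast-is-id refl xs)) (Vec.toList-injective refl xs ys eq)

-- As each word with n child symbols can be painted in 2ⁿ ways, there are at
-- most 2⁻ⁿ times as many of them as words with an additional letter.
module _ {d : ℕ} where

  paint : List (Fin (2 + d)) → List (Fin 2) → List (Fin (3 + d))
  paint []                u             = []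
  paint (zero ∷ w)        u             = zero ∷ paint w u
  -- A default for the case that the colours run out, which the length hypotheses below exclude.
  paint (suc zero ∷ w)    []            = []
  paint (suc zero ∷ w)    (zero ∷ u)    = suc zero ∷ paint w u
  paint (suc zero ∷ w)    (suc _ ∷ u)   = suc (suc zero) ∷ paint w u
  paint (suc (suc m) ∷ w) u             = suc (suc (suc m)) ∷ paint w u

  length-paint : ∀ w u → childSymbols w ≡ length u → length (paint w u) ≡ length w
  length-paint [] u eq = refl
  length-paint (zero ∷ w) u eq = cong suc (length-paint w u eq)
  length-paint (suc zero ∷ w) (zero ∷ u) eq = cong suc (length-paint w u (ℕ.suc-injective eq))
  length-paint (suc zero ∷ w) (suc _ ∷ u) eq = cong suc (length-paint w u (ℕ.suc-injective eq))
  length-paint (suc (suc m) ∷ w) u eq = cong suc (length-paint w u eq)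

  paint-injective : ∀ w w′ u u′ → childSymbols w ≡ length u → childSymbols w′ ≡ length u′ →
                    paint w u ≡ paint w′ u′ → w ≡ w′ × u ≡ u′
  paint-injective [] [] [] [] eq eq′ e = refl , refl
  paint-injective [] (suc zero ∷ w′) u (zero ∷ u′) eq eq′ ()
  paint-injective [] (suc zero ∷ w′) u (suc _ ∷ u′) eq eq′ ()
  paint-injective (zero ∷ w) (zero ∷ w′) u u′ eq eq′ e
    with paint-injective w w′ u u′ eq eq′ (List.∷-injectiveʳ e)
  ... | refl , refl = refl , refl
  paint-injective (zero ∷ w) (suc zero ∷ w′) u (zero ∷ u′) eq eq′ ()
  paint-injective (zero ∷ w) (suc zero ∷ w′) u (suc _ ∷ u′) eq eq′ ()
  paint-injective (suc zero ∷ w) [] (zero ∷ u) u′ eq eq′ ()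
  paint-injective (suc zero ∷ w) [] (suc _ ∷ u) u′ eq eq′ ()
  paint-injective (suc zero ∷ w) (zero ∷ w′) (zero ∷ u) u′ eq eq′ ()
  paint-injective (suc zero ∷ w) (zero ∷ w′) (suc _ ∷ u) u′ eq eq′ ()
  paint-injective (suc zero ∷ w) (suc zero ∷ w′) (zero ∷ u) (zero ∷ u′) eq eq′ e
    with paint-injective w w′ u u′ (ℕ.suc-injective eq) (ℕ.suc-injective eq′) (List.∷-injectiveʳ e)
  ... | refl , refl = refl , refl
  paint-injective (suc zero ∷ w) (suc zero ∷ w′) (suc zero ∷ u) (suc zero ∷ u′) eq eq′ e
    with paint-injective w w′ u u′ (ℕ.suc-injective eq) (ℕ.suc-injective eq′) (List.∷-injectiveʳ e)
  ... | refl , refl = refl , refl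
  paint-injective (suc zero ∷ w) (suc (suc _) ∷ w′) (zero ∷ u) u′ eq eq′ ()
  paint-injective (suc zero ∷ w) (suc (suc _) ∷ w′) (suc _ ∷ u) u′ eq eq′ ()
  paint-injective (suc (suc _) ∷ w) (suc zero ∷ w′) u (zero ∷ u′) eq eq′ ()
  paint-injective (suc (suc _) ∷ w) (suc zero ∷ w′) u (suc _ ∷ u′) eq eq′ ()
  paint-injective (suc (suc m) ∷ w) (suc (suc m′) ∷ w′) u u′ eq eq′ e
    with List.∷-injectiveˡ e | paint-injective w w′ u u′ eq eq′ (List.∷-injectiveʳ e)
  ... | refl | refl , refl = refl , refl

  -- The pairs of a code and a colouring of its n children inject into the painted words; n is one
  -- less than the number of simplices, as the root occupies no slot.
  codes-≤ : ∀ {m n} (code : Fin m → Code d) → (∀ {i j} → code i ≡ code j → i ≡ j) →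
            (∀ i → children (code i) ≡ n) → m * 2 ^ n ≤ (3 + d) ^ (suc d + d * n)
  codes-≤ {m} {n} code inj size = Fin.injective⇒≤ {f = f ∘ remQuot (2 ^ n)} injective
    where
    painting : Fin m × Fin (2 ^ n) → List (Fin (3 + d))
    painting (i , j) = paint (serialize (code i)) (toList (word-at n j))

    symbols : ∀ i (j : Fin (2 ^ n)) → childSymbols (serialize (code i)) ≡ length (toList (word-at n j))
    symbols i j =
      trans (cong childSymbols (sym (List.++-identityʳ (serialize (code i)))))
        (trans (childSymbols-serialize (code i) [])
          (trans (ℕ.+-identityʳ _) (trans (size i) (sym (Vec.length-toList (word-at n j))))))

    length-painting : ∀ ij → length (painting ij) ≡ suc d + d * n
    length-painting (i , j) = trans
      (length-paint (serialize (code i)) (toList (word-at n j)) (symbols i j))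
      (trans (length-serialize (code i)) (cong (λ x → suc d + d * x) (size i)))

    f : Fin m × Fin (2 ^ n) → Fin ((3 + d) ^ (suc d + d * n))
    f ij = word-index (Vec.cast (length-painting ij) (fromList (painting ij)))

    f-injective : ∀ ij ij′ → f ij ≡ f ij′ → ij ≡ ij′
    f-injective ij@(i , j) ij′@(i′ , j′) eq
      with paint-injective (serialize (code i)) (serialize (code i′)) _ _ (symbols i j) (symbols i′ j′)
             (trans (sym (unpack ij)) (trans (cong toList (word-index-injective _ _ eq)) (unpack ij′)))
      where
      unpack : ∀ ij → toList (Vec.cast (length-painting ij) (fromList (painting ij))) ≡ painting ij
      unpack ij = trans (Vec.toList-cast (length-painting ij) (fromList (painting ij)))
                        (Vec.toList∘fromList (painting ij))
    ... | eqᵂ , eqᵘ = cong₂ _,_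
      (inj (proj₁ (serialize-injective (code i) (code i′) (cong (_++ []) eqᵂ))))
      (word-at-injective n (toList-injective eqᵘ))

    injective : ∀ {x y} → f (remQuot (2 ^ n) x) ≡ f (remQuot (2 ^ n) y) → x ≡ y
    injective {x} {y} eq = trans (sym (Fin.combine-remQuot {m} (2 ^ n) x))
      (trans (cong (uncurry combine) (f-injective (remQuot {m} (2 ^ n) x) (remQuot {m} (2 ^ n) y) eq))
        (Fin.combine-remQuot {m} (2 ^ n) y))

encoded-≤ : ∀ {d n m} {K : Fin m → SimplicialComplex} →
            (∀ i → ∃ λ (r : Code d) → Encodes (suc n) (K i) r) →
            (∀ i j → i ≢ j → ¬ Isomorphic (K i) (K j)) →
            m * 2 ^ n ≤ (3 + d) ^ (suc d + d * n)
encoded-≤ {d} {n} {m} {K} encoding distinct =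
  codes-≤ (proj₁ ∘ encoding) injective λ i → ℕ.suc-injective (Encodes.size (proj₂ (encoding i)))
  where
  injective : ∀ {i j} → proj₁ (encoding i) ≡ proj₁ (encoding j) → i ≡ j
  injective {i} {j} eq with i ≟ j
  ... | yes i≡j = i≡j
  ... | no i≢j = ⊥-elim (distinct i j i≢j (encodes⇒isomorphic (proj₂ (encoding i))
          (subst (Encodes (suc n) (K j)) (sym eq) (proj₂ (encoding j)))))

LC-≤ : ∀ {d n} → 1 ≤ d → CountUpToIso (IsLC d (suc n)) λ m → m * 2 ^ n ≤ (3 + d) ^ (suc d + d * n)
LC-≤ 1≤d m K lc = encoded-≤ λ i → encode (K i) (lc i) 1≤d

-- Comparison of growth rates

^-distribʳ-* : ∀ m n o → (m * n) ^ o ≡ m ^ o * n ^ o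
^-distribʳ-* m n zero = refl
^-distribʳ-* m n (suc o) rewrite ^-distribʳ-* m n o =
  solve 4 (λ a b c e → (a :* b) :* (c :* e) := (a :* c) :* (b :* e)) refl m n (m ^ o) (n ^ o)
  where open +-*-Solver

^-comm : ∀ m n o → (m ^ n) ^ o ≡ (m ^ o) ^ n
^-comm m n o = trans (ℕ.^-*-assoc m n o) (trans (cong (m ^_) (ℕ.*-comm n o)) (sym (ℕ.^-*-assoc m o n)))

-- Bernoulli's inequality (1 + 1/p)^n ≥ 1 + n/p, cleared of denominators.
bernoulli : ∀ p n → p ^ n * (p + n) ≤ p * suc p ^ n
bernoulli p zero = ℕ.≤-reflexive (solve 1 (λ p → con 1 :* (p :+ con 0) := p :* con 1) refl p)
  where open +-*-Solver
bernoulli p (suc n) = begin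
  -- The added term completes a product: p (p + n + 1) + n = (p + 1) (p + n).
  p * p ^ n * (p + suc n)                 ≤⟨ ℕ.m≤m+n _ (p ^ n * n) ⟩
  p * p ^ n * (p + suc n) + p ^ n * n     ≡⟨ solve 3 (λ p x n → p :* x :* (p :+ (con 1 :+ n)) :+ x :* n :=
                                                       (con 1 :+ p) :* (x :* (p :+ n))) refl p (p ^ n) n ⟩
  suc p * (p ^ n * (p + n))               ≤⟨ ℕ.*-monoʳ-≤ (suc p) (bernoulli p n) ⟩
  suc p * (p * suc p ^ n)                 ≡⟨ solve 3 (λ a b c → a :* (b :* c) := b :* (a :* c))
                                               refl (suc p) p (suc p ^ n) ⟩
  p * (suc p * suc p ^ n)                 ∎
  where
  open ℕ.≤-Reasoning
  open +-*-Solver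

-- Since q is at least p + 1, Bernoulli bounds (q/p)^n below by 1 + n/p, which exceeds c once n is
-- at least c p.
exponential-≤ : ∀ c {p q} .{{_ : NonZero p}} → p < q → ∀ {n} → c * p ≤ n → c * p ^ n ≤ q ^ n
exponential-≤ c {p} {q} p<q {n} cp≤n = ℕ.*-cancelˡ-≤ p (begin
  p * (c * p ^ n)   ≡⟨ solve 3 (λ p c x → p :* (c :* x) := x :* (c :* p)) refl p c (p ^ n) ⟩
  p ^ n * (c * p)   ≤⟨ ℕ.*-monoʳ-≤ (p ^ n) (ℕ.≤-trans cp≤n (ℕ.m≤n+m n p)) ⟩
  p ^ n * (p + n)   ≤⟨ bernoulli p n ⟩
  p * suc p ^ n     ≤⟨ ℕ.*-monoʳ-≤ p (ℕ.^-monoˡ-≤ n p<q) ⟩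
  p * q ^ n         ∎)
  where
  open ℕ.≤-Reasoning
  open +-*-Solver

-- The cubes of the growth rates in N of the number of painted words and of
-- the bound, both multiplied by the denominator of the bound.
rate : ℕ → ℕ
rate d = ((3 + d) ^ d * (d ∸ 1) ^ (d ∸ 1)) ^ 3

bound-rate : ℕ → ℕ
bound-rate d = (d * d ^ (d ∸ 1)) ^ 3 * 2 ^ (2 * d ^ 2 ∸ d)

-- With d = 5 + e this reads (3 + d)^3 ≤ 2^(2d - 1), an equality at d = 5; its d-th power has the
-- exponent 2d² - d of the bound.
cube-≤ : ∀ e → (8 + e) ^ 3 ≤ 2 ^ (9 + 2 * e)
cube-≤ zero = ℕ.≤-refl
cube-≤ (suc e) = begin
  (9 + e) ^ 3               ≤⟨ ℕ.m≤m+n _ _ ⟩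
  -- The added polynomial is 4 (8 + e)^3 - (9 + e)^3, whose coefficients are all positive.
  (9 + e) ^ 3 + (1319 + 525 * e + 69 * (e * e) + 3 * (e * (e * e)))
                            ≡⟨ solve 1 (λ e → (con 9 :+ e) :^ 3 :+
                                 (con 1319 :+ con 525 :* e :+ con 69 :* (e :* e) :+ con 3 :* (e :* (e :* e)))
                                 := con 4 :* (con 8 :+ e) :^ 3) refl e ⟩
  4 * (8 + e) ^ 3           ≤⟨ ℕ.*-monoʳ-≤ 4 (cube-≤ e) ⟩
  4 * 2 ^ (9 + 2 * e)       ≡⟨ sym (ℕ.^-distribˡ-+-* 2 2 (9 + 2 * e)) ⟩
  2 ^ (2 + (9 + 2 * e))     ≡⟨ cong (2 ^_) (solve 1 (λ e → con 2 :+ (con 9 :+ con 2 :* e) :=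
                                 con 9 :+ con 2 :* (con 1 :+ e)) refl e) ⟩
  2 ^ (9 + 2 * suc e)       ∎
  where
  open ℕ.≤-Reasoning
  open +-*-Solver

-- The factor 8 is the cube of the 2 gained per simplex by painting. For these d the rates compare
-- without it, and it makes the inequality strict.
rate-<-large : ∀ e → rate (5 + e) < 8 * bound-rate (5 + e)
rate-<-large e = begin-strict
  ((3 + d) ^ d * (d ∸ 1) ^ (d ∸ 1)) ^ 3           ≡⟨ ^-distribʳ-* ((3 + d) ^ d) _ 3 ⟩
  ((3 + d) ^ d) ^ 3 * ((d ∸ 1) ^ (d ∸ 1)) ^ 3     ≤⟨ ℕ.*-mono-≤ first (ℕ.^-monoˡ-≤ 3 second) ⟩
  2 ^ (2 * d ^ 2 ∸ d) * (d * d ^ (d ∸ 1)) ^ 3     ≡⟨ ℕ.*-comm (2 ^ (2 * d ^ 2 ∸ d)) _ ⟩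
  bound-rate d                                    <⟨ ℕ.m<m*n (bound-rate d) 8 {{nz}} (s≤s (s≤s z≤n)) ⟩
  bound-rate d * 8                                ≡⟨ ℕ.*-comm (bound-rate d) 8 ⟩
  8 * bound-rate d                                ∎
  where
  open ℕ.≤-Reasoning
  d = 5 + e
  exponent : (9 + 2 * e) * d ≡ 2 * d ^ 2 ∸ d
  exponent = trans (sym (ℕ.m+n∸m≡n d _)) (cong (_∸ d)
    (solve 1 (λ e → (con 5 :+ e) :+ (con 9 :+ con 2 :* e) :* (con 5 :+ e) :=
                    con 2 :* (con 5 :+ e) :^ 2) refl e))
    where open +-*-Solver
  first : ((3 + d) ^ d) ^ 3 ≤ 2 ^ (2 * d ^ 2 ∸ d)
  first = begin
    ((3 + d) ^ d) ^ 3        ≡⟨ ^-comm (3 + d) d 3 ⟩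
    ((3 + d) ^ 3) ^ d        ≤⟨ ℕ.^-monoˡ-≤ d (cube-≤ e) ⟩
    (2 ^ (9 + 2 * e)) ^ d    ≡⟨ ℕ.^-*-assoc 2 (9 + 2 * e) d ⟩
    2 ^ ((9 + 2 * e) * d)    ≡⟨ cong (2 ^_) exponent ⟩
    2 ^ (2 * d ^ 2 ∸ d)      ∎
  second : (d ∸ 1) ^ (d ∸ 1) ≤ d * d ^ (d ∸ 1)
  second = ℕ.≤-trans (ℕ.^-monoˡ-≤ (d ∸ 1) (ℕ.m∸n≤m d 1)) (ℕ.m≤n*m (d ^ (d ∸ 1)) d)
  nz : NonZero (bound-rate d)
  nz = ℕ.m*n≢0 _ _ {{ℕ.m^n≢0 (d * d ^ (d ∸ 1)) 3 {{ℕ.m^n≢0 d d}}}} {{ℕ.m^n≢0 2 (2 * d ^ 2 ∸ d)}}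

-- For d below 5, (3 + d)^3 exceeds 2^(2d - 1), so these cases are settled by evaluating both sides.
rate-< : ∀ {d} → 2 ≤ d → rate d < 8 * bound-rate d
rate-< {2} _ = toWitness {a? = rate 2 ℕ.<? 8 * bound-rate 2} _
rate-< {3} _ = toWitness {a? = rate 3 ℕ.<? 8 * bound-rate 3} _
rate-< {4} _ = toWitness {a? = rate 4 ℕ.<? 8 * bound-rate 4} _
rate-< {suc (suc (suc (suc (suc e))))} _ = rate-<-large e
rate-< {1} (s≤s ())

-- The constant 2 (3 + d) comes from 2^N = 2 · 2^n and from the one slot by which dN + 1 exceeds dN.
-- The strict gap between the rates absorbs its cube for large N.
codes-bound : ∀ {d m n} → 2 ≤ d → (2 * (3 + d)) ^ 3 * rate d ≤ suc n →
              m * 2 ^ n ≤ (3 + d) ^ (suc d + d * n) → Bound d (suc n) m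
codes-bound {d} {m} {n} 2≤d large count = ℕ.*-cancelˡ-≤ (8 ^ N) {{ℕ.m^n≢0 8 N}} (begin
  8 ^ N * (m * B ^ N) ^ 3              ≡⟨ cong (_* (m * B ^ N) ^ 3) (^-comm 2 3 N) ⟩
  (2 ^ N) ^ 3 * (m * B ^ N) ^ 3        ≡⟨ sym (^-distribʳ-* (2 ^ N) (m * B ^ N) 3) ⟩
  (2 ^ N * (m * B ^ N)) ^ 3            ≡⟨ cong (_^ 3) (solve 3 (λ x m b → con 2 :* x :* (m :* b) :=
                                            con 2 :* (m :* x) :* b) refl (2 ^ n) m (B ^ N)) ⟩
  (2 * (m * 2 ^ n) * B ^ N) ^ 3        ≤⟨ ℕ.^-monoˡ-≤ 3 (ℕ.*-monoˡ-≤ (B ^ N) (ℕ.*-monoʳ-≤ 2 count)) ⟩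
  (2 * (3 + d) ^ (suc d + d * n) * B ^ N) ^ 3
                                       ≡⟨ cong (λ x → (2 * x * B ^ N) ^ 3) power ⟩
  (2 * ((3 + d) * A ^ N) * B ^ N) ^ 3  ≡⟨ cong (_^ 3) (solve 3 (λ c x y → con 2 :* (c :* x) :* y :=
                                            con 2 :* c :* (x :* y)) refl (3 + d) (A ^ N) (B ^ N)) ⟩
  (2 * (3 + d) * (A ^ N * B ^ N)) ^ 3  ≡⟨ cong (λ x → (2 * (3 + d) * x) ^ 3) (sym (^-distribʳ-* A B N)) ⟩
  (2 * (3 + d) * (A * B) ^ N) ^ 3      ≡⟨ ^-distribʳ-* (2 * (3 + d)) ((A * B) ^ N) 3 ⟩
  (2 * (3 + d)) ^ 3 * ((A * B) ^ N) ^ 3 ≡⟨ cong ((2 * (3 + d)) ^ 3 *_) (^-comm (A * B) N 3) ⟩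
  (2 * (3 + d)) ^ 3 * rate d ^ N       ≤⟨ exponential-≤ ((2 * (3 + d)) ^ 3) {{nz}} (rate-< 2≤d) large ⟩
  (8 * bound-rate d) ^ N               ≡⟨ ^-distribʳ-* 8 (bound-rate d) N ⟩
  8 ^ N * bound-rate d ^ N             ∎)
  where
  open ℕ.≤-Reasoning
  open +-*-Solver
  N = suc n
  A = (3 + d) ^ d
  B = (d ∸ 1) ^ (d ∸ 1)
  nz : NonZero (rate d)
  nz = ℕ.m^n≢0 (A * B) 3 {{ℕ.m*n≢0 A B {{ℕ.m^n≢0 (3 + d) d}}
         {{ℕ.m^n≢0 (d ∸ 1) (d ∸ 1) {{ℕ.>-nonZero (ℕ.m<n⇒0<n∸m 2≤d)}}}}}}
  power : (3 + d) ^ (suc d + d * n) ≡ (3 + d) * A ^ N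
  power = cong ((3 + d) *_) (trans (cong ((3 + d) ^_) (sym (ℕ.*-suc d n))) (sym (ℕ.^-*-assoc (3 + d) d N)))

-- The successor makes N positive, so that N can be written as one root and n children.
threshold : ℕ → ℕ
threshold d = suc ((2 * (3 + d)) ^ 3 * rate d)

LC-bound : ∀ {d} → 2 ≤ d → ∀ N → threshold d ≤ N → CountUpToIso (IsLC d N) (Bound d N)
LC-bound 2≤d (suc n) large m K lc distinct =
  codes-bound {m = m} 2≤d (ℕ.≤-trans (ℕ.n≤1+n _) large) (LC-≤ (ℕ.≤-trans (s≤s z≤n) 2≤d) m K lc distinct)

theorem4p4 : ∀ (d : ℕ) → 2 ≤ d →
    (∃ λ (N₀ : ℕ) → ∀ (N : ℕ) → N₀ ≤ N →
    CountUpToIso (λ C → IsSphere d C × IsLC d N C) (Bound d N))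
    ×
    (∃ λ (N₀ : ℕ) → ∀ (N : ℕ) → N₀ ≤ N →
    CountUpToIso (λ C → IsBall d C × IsLC d N C) (Bound d N))
theorem4p4 d 2≤d =
  (threshold d , λ N N₀≤N m K lc → LC-bound 2≤d N N₀≤N m K (proj₂ ∘ lc)) ,
  (threshold d , λ N N₀≤N m K lc → LC-bound 2≤d N N₀≤N m K (proj₂ ∘ lc))
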